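{- Let $k \geq 2$ be an integer, let $F_n^{(k)}$ denote the $n$-th $k$-generalized Fibonacci number, and let $\alpha$ be the unique positive real root of $x^k - x^{k-1} - \cdots - x - 1 = 0$. Then for all integers $n \geq 2-k$, $$F_n^{(k)} = \mathrm{Round}\left[ \frac{\alpha - 1}{2 + (k+1)(\alpha - 2)}\, \alpha^{n-1} \right].$$
   Context: For an integer $k \geq 2$, the $k$-generalized Fibonacci numbers $F_n^{(k)}$ (for integers $n \geq 2-k$) are defined by the $k$ initial values $F_n^{(k)} = 0$ for $2-k \leq n \leq 0$ and $F_1^{(k)} = 1$, together with the recurrence $F_n^{(k)} = F_{n-1}^{(k)} + F_{n-2}^{(k)} + \cdots + F_{n-k}^{(k)}$ for all $n \geq 2$. For a real number $x$, $\mathrm{Round}[x]$ denotes the integer closest to $x$. -}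

module Defs where

open import Algebra.Bundles using (CommutativeRing)
open import Data.Fin.Base using (toℕ)
open import Data.Integer.Base as ℤ using (ℤ; +_; -[1+_]; _⊖_)
import Data.Integer.Properties as ℤ
import Algebra.Properties.Monoid.Sum ℤ.+-0-monoid as ℤΣ
open import Data.Nat.Base as ℕ using (ℕ; zero; suc; s≤s)
import Data.Nat.Properties as ℕ
open import Data.Product.Base using (_×_; _,_; ∃; proj₁; proj₂)
open import Data.Rational.Base as ℚ using (ℚ; 0ℚ; 1ℚ; ½)
import Data.Rational.Properties as ℚ
open import Data.Rational.Solver using (module +-*-Solver)
open import Data.Sum.Base using (_⊎_; inj₁; inj₂)
open import Function.Base using (_∘_)
open import Level using (0ℓ)
open import Relation.Binary.PropositionalEquality
  using (_≡_; _≢_; _≗_; refl; sym; trans; cong; cong₂; subst)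
open import Relation.Nullary.Decidable.Core using (yes; no)
open import Relation.Nullary.Negation.Core using (contradiction)

open +-*-Solver using (solve; _:=_; _:+_; _:*_; _:-_; :-_; con)

dist : ℚ → ℚ → ℚ
dist p q = ℚ.∣ p ℚ.- q ∣

dist-refl : ∀ p → dist p p ≡ 0ℚ
dist-refl p = cong ℚ.∣_∣ (ℚ.+-inverseʳ p)

dist-sym : ∀ p q → dist p q ≡ dist q p
dist-sym p q = trans
  (cong ℚ.∣_∣ (solve 2 (λ p q → p :- q := :- (q :- p)) refl p q))
  (ℚ.∣-p∣≡∣p∣ (q ℚ.- p))

dist-triangle : ∀ p q r → dist p r ℚ.≤ dist p q ℚ.+ dist q r
dist-triangle p q r = subst (ℚ._≤ dist p q ℚ.+ dist q r)
  (cong ℚ.∣_∣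
    (solve 3 (λ p q r → (p :- q) :+ (q :- r) := p :- r) refl p q r))
  (ℚ.∣p+q∣≤∣p∣+∣q∣ (p ℚ.- q) (q ℚ.- r))

dist-+ : ∀ p q r s →
         dist (p ℚ.+ q) (r ℚ.+ s) ℚ.≤ dist p r ℚ.+ dist q s
dist-+ p q r s = subst (ℚ._≤ dist p r ℚ.+ dist q s)
  (cong ℚ.∣_∣ (solve 4
    (λ p q r s → (p :- r) :+ (q :- s) := (p :+ q) :- (r :+ s))
    refl p q r s))
  (ℚ.∣p+q∣≤∣p∣+∣q∣ (p ℚ.- r) (q ℚ.- s))

dist-neg : ∀ p q → dist (ℚ.- p) (ℚ.- q) ≡ dist p q
dist-neg p q = trans
  (cong ℚ.∣_∣ (solve 2 (λ p q → (:- p) :- (:- q) := :- (p :- q)) refl p q))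
  (ℚ.∣-p∣≡∣p∣ (p ℚ.- q))

dist-* : ∀ p q r s →
         dist (p ℚ.* q) (r ℚ.* s) ℚ.≤
         ℚ.∣ p ∣ ℚ.* dist q s ℚ.+ ℚ.∣ s ∣ ℚ.* dist p r
dist-* p q r s = begin
  dist (p ℚ.* q) (r ℚ.* s)
    ≡⟨ cong ℚ.∣_∣ (solve 4
         (λ p q r s →
            (p :* q) :- (r :* s) := p :* (q :- s) :+ s :* (p :- r))
         refl p q r s) ⟩
  ℚ.∣ p ℚ.* (q ℚ.- s) ℚ.+ s ℚ.* (p ℚ.- r) ∣
    ≤⟨ ℚ.∣p+q∣≤∣p∣+∣q∣ (p ℚ.* (q ℚ.- s)) (s ℚ.* (p ℚ.- r)) ⟩
  ℚ.∣ p ℚ.* (q ℚ.- s) ∣ ℚ.+ ℚ.∣ s ℚ.* (p ℚ.- r) ∣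
    ≡⟨ cong₂ ℚ._+_ (ℚ.∣p*q∣≡∣p∣*∣q∣ p (q ℚ.- s))
                   (ℚ.∣p*q∣≡∣p∣*∣q∣ s (p ℚ.- r)) ⟩
  ℚ.∣ p ∣ ℚ.* dist q s ℚ.+ ℚ.∣ s ∣ ℚ.* dist p r ∎
  where open ℚ.≤-Reasoning

∣p∣≤dist+∣q∣ : ∀ p q → ℚ.∣ p ∣ ℚ.≤ dist p q ℚ.+ ℚ.∣ q ∣
∣p∣≤dist+∣q∣ p q = subst (λ r → ℚ.∣ r ∣ ℚ.≤ dist p q ℚ.+ ℚ.∣ q ∣)
  (solve 2 (λ p q → (p :- q) :+ q := p) refl p q)
  (ℚ.∣p+q∣≤∣p∣+∣q∣ (p ℚ.- q) q)

≤+⇒-≤ : ∀ {p q r} → p ℚ.≤ q ℚ.+ r → p ℚ.- r ℚ.≤ q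
≤+⇒-≤ {p} {q} {r} p≤q+r = subst (p ℚ.- r ℚ.≤_)
  (solve 2 (λ q r → (q :+ r) :- r := q) refl q r)
  (ℚ.+-monoˡ-≤ (ℚ.- r) p≤q+r)

dist-∣∣ : ∀ p q → dist ℚ.∣ p ∣ ℚ.∣ q ∣ ℚ.≤ dist p q
dist-∣∣ p q with ℚ.∣p∣≡p∨∣p∣≡-p (ℚ.∣ p ∣ ℚ.- ℚ.∣ q ∣)
... | inj₁ eq = subst (ℚ._≤ dist p q) (sym eq) (≤+⇒-≤ (∣p∣≤dist+∣q∣ p q))
... | inj₂ eq = subst (ℚ._≤ dist p q)
  (trans (solve 2 (λ a b → b :- a := :- (a :- b)) refl ℚ.∣ p ∣ ℚ.∣ q ∣)
         (sym eq))
  (≤+⇒-≤ (subst (λ d → ℚ.∣ q ∣ ℚ.≤ d ℚ.+ ℚ.∣ p ∣) (dist-sym q p)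
                (∣p∣≤dist+∣q∣ q p)))

p≤∣p∣ : ∀ p → p ℚ.≤ ℚ.∣ p ∣
p≤∣p∣ p with ℚ.≤-total 0ℚ p
... | inj₁ 0≤p = ℚ.≤-reflexive (sym (ℚ.0≤p⇒∣p∣≡p 0≤p))
... | inj₂ p≤0 = ℚ.≤-trans p≤0 (ℚ.0≤∣p∣ p)

*-pos : ∀ {p q} → 0ℚ ℚ.< p → 0ℚ ℚ.< q → 0ℚ ℚ.< p ℚ.* q
*-pos {p} {q} 0<p 0<q =
  ℚ.positive⁻¹ (p ℚ.* q)
    {{ℚ.pos*pos⇒pos p {{ℚ.positive 0<p}} q {{ℚ.positive 0<q}}}}

+-pos : ∀ {p q} → 0ℚ ℚ.< p → 0ℚ ℚ.≤ q → 0ℚ ℚ.< p ℚ.+ q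
+-pos = ℚ.+-mono-<-≤

0<1 : 0ℚ ℚ.< 1ℚ
0<1 = ℚ.positive⁻¹ 1ℚ

half : ℚ → ℚ
half ε = ½ ℚ.* ε

half-pos : ∀ {ε} → 0ℚ ℚ.< ε → 0ℚ ℚ.< half ε
half-pos = *-pos (ℚ.positive⁻¹ ½)

half+half : ∀ ε → half ε ℚ.+ half ε ≡ ε
half+half = solve 1 (λ e → con ½ :* e :+ con ½ :* e := e) refl

<half+<half : ∀ {p q ε} → p ℚ.< half ε → q ℚ.< half ε → p ℚ.+ q ℚ.< ε
<half+<half {p} {q} {ε} p< q< =
  subst (p ℚ.+ q ℚ.<_) (half+half ε) (ℚ.+-mono-< p< q<)

-- The inverse of a nonzero rational, with 1/0 = 0.
recip : ℚ → ℚ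
recip q with q ℚ.≟ 0ℚ
... | yes _  = 0ℚ
... | no q≢0 = (ℚ.1/ q) {{ℚ.≢-nonZero q≢0}}

recip-inverseʳ : ∀ {q} → q ≢ 0ℚ → q ℚ.* recip q ≡ 1ℚ
recip-inverseʳ {q} q≢0 with q ℚ.≟ 0ℚ
... | yes q≡0 = contradiction q≡0 q≢0
... | no  q≢0 = ℚ.*-inverseʳ q {{ℚ.≢-nonZero q≢0}}

pos⇒≢0 : ∀ {q} → 0ℚ ℚ.< q → q ≢ 0ℚ
pos⇒≢0 0<q refl = ℚ.<-irrefl refl 0<q

recip-pos : ∀ {q} → 0ℚ ℚ.< q → 0ℚ ℚ.< recip q
recip-pos {q} 0<q = ℚ.*-cancelˡ-<-nonNeg q
  {{ℚ.nonNegative (ℚ.<⇒≤ 0<q)}}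
  (subst (ℚ._< q ℚ.* recip q) (sym (ℚ.*-zeroʳ q))
    (subst (0ℚ ℚ.<_) (sym (recip-inverseʳ (pos⇒≢0 0<q))) 0<1))

*-monoˡ-≤ : ∀ {p q r} → 0ℚ ℚ.≤ r → p ℚ.≤ q → r ℚ.* p ℚ.≤ r ℚ.* q
*-monoˡ-≤ {r = r} 0≤r = ℚ.*-monoˡ-≤-nonNeg r {{ℚ.nonNegative 0≤r}}

*-monoʳ-≤ : ∀ {p q r} → 0ℚ ℚ.≤ r → p ℚ.≤ q → p ℚ.* r ℚ.≤ q ℚ.* r
*-monoʳ-≤ {r = r} 0≤r = ℚ.*-monoʳ-≤-nonNeg r {{ℚ.nonNegative 0≤r}}

*-monoˡ-< : ∀ {p q r} → 0ℚ ℚ.< r → p ℚ.< q → r ℚ.* p ℚ.< r ℚ.* q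
*-monoˡ-< {r = r} 0<r = ℚ.*-monoʳ-<-pos r {{ℚ.positive 0<r}}

-- If p, s are bounded by K, then q, s and p, r being tolerance ε K-close
-- makes the products p q and r s ε-close.
tolerance : ℚ → ℚ → ℚ
tolerance ε K = half ε ℚ.* recip K

tolerance-pos : ∀ {ε K} → 0ℚ ℚ.< ε → 0ℚ ℚ.< K → 0ℚ ℚ.< tolerance ε K
tolerance-pos 0<ε 0<K = *-pos (half-pos 0<ε) (recip-pos 0<K)

dist-*-< : ∀ {p q r s ε K} → 0ℚ ℚ.< K →
           ℚ.∣ p ∣ ℚ.≤ K → ℚ.∣ s ∣ ℚ.≤ K →
           dist p r ℚ.< tolerance ε K → dist q s ℚ.< tolerance ε K →
           dist (p ℚ.* q) (r ℚ.* s) ℚ.< ε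
dist-*-< {p} {q} {r} {s} {ε} {K} 0<K p≤K s≤K p~r q~s =
  ℚ.≤-<-trans (dist-* p q r s)
    (<half+<half (bound p≤K q~s (ℚ.0≤∣p∣ (q ℚ.- s)))
                 (bound s≤K p~r (ℚ.0≤∣p∣ (p ℚ.- r))))
  where
  K*tolerance : K ℚ.* tolerance ε K ≡ half ε
  K*tolerance = trans
    (solve 3 (λ k h i → k :* (h :* i) := h :* (k :* i)) refl
      K (half ε) (recip K))
    (trans (cong (half ε ℚ.*_) (recip-inverseʳ (pos⇒≢0 0<K)))
           (ℚ.*-identityʳ (half ε)))

  bound : ∀ {a d} → a ℚ.≤ K → d ℚ.< tolerance ε K → 0ℚ ℚ.≤ d →
          a ℚ.* d ℚ.< half ε
  bound a≤K d< 0≤d = ℚ.≤-<-trans (*-monoʳ-≤ 0≤d a≤K)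
    (subst (_ ℚ.<_) K*tolerance (*-monoˡ-< 0<K d<))

-- For p, q at distance at least δ from 0, |1/p - 1/q| ≤ |q - p| / δ².
dist-recip-< : ∀ {p q δ ε} → 0ℚ ℚ.< δ → δ ℚ.≤ ℚ.∣ p ∣ → δ ℚ.≤ ℚ.∣ q ∣ →
               dist p q ℚ.< δ ℚ.* δ ℚ.* ε → dist (recip p) (recip q) ℚ.< ε
dist-recip-< {p} {q} {δ} {ε} 0<δ δ≤p δ≤q p~q =
  ℚ.*-cancelˡ-<-nonNeg (δ ℚ.* δ) {{ℚ.nonNegative (ℚ.<⇒≤ (*-pos 0<δ 0<δ))}}
    (ℚ.≤-<-trans lemma p~q)
  where
  open ℚ.≤-Reasoning

  ≢0 : ∀ {r} → δ ℚ.≤ ℚ.∣ r ∣ → r ≢ 0ℚ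
  ≢0 δ≤0 refl = ℚ.<-irrefl refl (ℚ.<-≤-trans 0<δ δ≤0)

  scale : p ℚ.* q ℚ.* (recip p ℚ.- recip q) ≡ q ℚ.- p
  scale = trans
    (solve 4 (λ p q r s → p :* q :* (r :- s) := q :* (p :* r) :- p :* (q :* s))
      refl p q (recip p) (recip q))
    (cong₂ ℚ._-_
      (trans (cong (q ℚ.*_) (recip-inverseʳ (≢0 δ≤p))) (ℚ.*-identityʳ q))
      (trans (cong (p ℚ.*_) (recip-inverseʳ (≢0 δ≤q))) (ℚ.*-identityʳ p)))

  lemma : δ ℚ.* δ ℚ.* dist (recip p) (recip q) ℚ.≤ dist p q
  lemma = begin
    δ ℚ.* δ ℚ.* dist (recip p) (recip q)
      ≤⟨ *-monoʳ-≤ (ℚ.0≤∣p∣ (recip p ℚ.- recip q))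
           (ℚ.≤-trans (*-monoˡ-≤ (ℚ.<⇒≤ 0<δ) δ≤q)
                      (*-monoʳ-≤ (ℚ.0≤∣p∣ q) δ≤p)) ⟩
    ℚ.∣ p ∣ ℚ.* ℚ.∣ q ∣ ℚ.* dist (recip p) (recip q)
      ≡⟨ cong (ℚ._* dist (recip p) (recip q)) (ℚ.∣p*q∣≡∣p∣*∣q∣ p q) ⟨
    ℚ.∣ p ℚ.* q ∣ ℚ.* dist (recip p) (recip q)
      ≡⟨ ℚ.∣p*q∣≡∣p∣*∣q∣ (p ℚ.* q) (recip p ℚ.- recip q) ⟨
    ℚ.∣ p ℚ.* q ℚ.* (recip p ℚ.- recip q) ∣
      ≡⟨ cong ℚ.∣_∣ scale ⟩
    dist q p
      ≡⟨ dist-sym q p ⟩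
    dist p q ∎

IsCauchy : (ℕ → ℚ) → Set
IsCauchy u = ∀ ε → 0ℚ ℚ.< ε →
  ∃ λ N → ∀ m n → N ℕ.≤ m → N ℕ.≤ n → dist (u m) (u n) ℚ.< ε

-- ℝ is the setoid of Cauchy sequences of rationals under _≈_.
record ℝ : Set where
  constructor mkℝ
  field
    seq    : ℕ → ℚ
    cauchy : IsCauchy seq

open ℝ public

infix 4 _≈_ _<_ _#_

record _≈_ (x y : ℝ) : Set where
  constructor mk≈
  field
    close : ∀ ε → 0ℚ ℚ.< ε →
      ∃ λ N → ∀ n → N ℕ.≤ n → dist (seq x n) (seq y n) ℚ.< ε

open _≈_ public

-- The margin ε must not depend on n: a strict pointwise inequality of the
-- sequences does not prevent equality of the limits.
record _<_ (x y : ℝ) : Set where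
  constructor mk<
  field
    margin     : ℚ
    margin-pos : 0ℚ ℚ.< margin
    separated  : ∃ λ N → ∀ n → N ℕ.≤ n → seq x n ℚ.+ margin ℚ.≤ seq y n

open _<_ public

_#_ : ℝ → ℝ → Set
x # y = x < y ⊎ y < x

⊔≤ˡ : ∀ m n {o} → m ℕ.⊔ n ℕ.≤ o → m ℕ.≤ o
⊔≤ˡ m n = ℕ.≤-trans (ℕ.m≤m⊔n m n)

⊔≤ʳ : ∀ m n {o} → m ℕ.⊔ n ℕ.≤ o → n ℕ.≤ o
⊔≤ʳ m n = ℕ.≤-trans (ℕ.m≤n⊔m m n)

≗⇒≈ : ∀ {x y} → seq x ≗ seq y → x ≈ y
≗⇒≈ {x} {y} eq = mk≈ λ ε 0<ε → 0 , λ n _ →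
  subst (ℚ._< ε)
    (sym (trans (cong (λ q → dist q (seq y n)) (eq n)) (dist-refl (seq y n))))
    0<ε

≈-refl : ∀ {x} → x ≈ x
≈-refl = ≗⇒≈ λ _ → refl

≈-sym : ∀ {x y} → x ≈ y → y ≈ x
≈-sym {x} {y} x≈y = mk≈ λ ε 0<ε → let N , near = close x≈y ε 0<ε in
  N , λ n N≤n → subst (ℚ._< ε) (dist-sym (seq x n) (seq y n)) (near n N≤n)

≈-trans : ∀ {x y z} → x ≈ y → y ≈ z → x ≈ z
≈-trans {x} {y} {z} x≈y y≈z = mk≈ λ ε 0<ε →
  let M , near₁ = close x≈y (half ε) (half-pos 0<ε)
      N , near₂ = close y≈z (half ε) (half-pos 0<ε)
  in M ℕ.⊔ N , λ n M⊔N≤n →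
    ℚ.≤-<-trans (dist-triangle (seq x n) (seq y n) (seq z n))
      (<half+<half (near₁ n (⊔≤ˡ M N M⊔N≤n))
                   (near₂ n (⊔≤ʳ M N M⊔N≤n)))

bounded : ∀ x → ∃ λ K → 0ℚ ℚ.< K ×
          ∃ λ N → ∀ n → N ℕ.≤ n → ℚ.∣ seq x n ∣ ℚ.≤ K
bounded x =
  let N , near = cauchy x 1ℚ 0<1
      q = seq x N
  in 1ℚ ℚ.+ ℚ.∣ q ∣ , +-pos 0<1 (ℚ.0≤∣p∣ q) , N , λ n N≤n →
    ℚ.≤-trans (∣p∣≤dist+∣q∣ (seq x n) q)
      (ℚ.+-monoˡ-≤ ℚ.∣ q ∣ (ℚ.<⇒≤ (near n N N≤n ℕ.≤-refl)))

bounded₂ : ∀ x y → ∃ λ K → 0ℚ ℚ.< K × ∃ λ N → ∀ n → N ℕ.≤ n →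
           ℚ.∣ seq x n ∣ ℚ.≤ K × ℚ.∣ seq y n ∣ ℚ.≤ K
bounded₂ x y =
  let K , 0<K , M , x≤K = bounded x
      L , 0<L , N , y≤L = bounded y
  in K ℚ.+ L , +-pos 0<K (ℚ.<⇒≤ 0<L) , M ℕ.⊔ N , λ n M⊔N≤n →
    ℚ.≤-trans (x≤K n (⊔≤ˡ M N M⊔N≤n))
      (subst (ℚ._≤ K ℚ.+ L) (ℚ.+-identityʳ K) (ℚ.+-monoʳ-≤ K (ℚ.<⇒≤ 0<L))) ,
    ℚ.≤-trans (y≤L n (⊔≤ʳ M N M⊔N≤n))
      (subst (ℚ._≤ K ℚ.+ L) (ℚ.+-identityˡ L) (ℚ.+-monoˡ-≤ L (ℚ.<⇒≤ 0<K)))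

-- Opacity keeps the moduli of convergence from being unfolded when real
-- numbers are compared during type checking.
opaque
  const-cauchy : ∀ q → IsCauchy λ _ → q
  const-cauchy q ε 0<ε = 0 , λ _ _ _ _ →
    subst (ℚ._< ε) (sym (dist-refl q)) 0<ε

  +-cauchy : ∀ x y → IsCauchy λ n → seq x n ℚ.+ seq y n
  +-cauchy x y ε 0<ε =
    let M , near₁ = cauchy x (half ε) (half-pos 0<ε)
        N , near₂ = cauchy y (half ε) (half-pos 0<ε)
    in M ℕ.⊔ N , λ m n ≤m ≤n →
      ℚ.≤-<-trans (dist-+ (seq x m) (seq y m) (seq x n) (seq y n))
        (<half+<half
          (near₁ m n (⊔≤ˡ M N ≤m) (⊔≤ˡ M N ≤n))
          (near₂ m n (⊔≤ʳ M N ≤m) (⊔≤ʳ M N ≤n)))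

  neg-cauchy : ∀ x → IsCauchy λ n → ℚ.- seq x n
  neg-cauchy x ε 0<ε =
    let N , near = cauchy x ε 0<ε
    in N , λ m n ≤m ≤n →
      subst (ℚ._< ε) (sym (dist-neg (seq x m) (seq x n))) (near m n ≤m ≤n)

  *-cauchy : ∀ x y → IsCauchy λ n → seq x n ℚ.* seq y n
  *-cauchy x y ε 0<ε =
    let K , 0<K , L , ≤K = bounded₂ x y
        0<δ = tolerance-pos 0<ε 0<K
        M , near₁ = cauchy x (tolerance ε K) 0<δ
        N , near₂ = cauchy y (tolerance ε K) 0<δ
        L≤ = λ {n} → ⊔≤ˡ L (M ℕ.⊔ N) {n}
        M≤ = λ {n} → ⊔≤ˡ M N {n} ∘ ⊔≤ʳ L (M ℕ.⊔ N)
        N≤ = λ {n} → ⊔≤ʳ M N {n} ∘ ⊔≤ʳ L (M ℕ.⊔ N)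
    in L ℕ.⊔ (M ℕ.⊔ N) , λ m n ≤m ≤n →
      dist-*-< {p = seq x m} {q = seq y m} {r = seq x n} {s = seq y n} 0<K
        (proj₁ (≤K m (L≤ ≤m))) (proj₂ (≤K n (L≤ ≤n)))
        (near₁ m n (M≤ ≤m) (M≤ ≤n)) (near₂ m n (N≤ ≤m) (N≤ ≤n))

  abs-cauchy : ∀ x → IsCauchy λ n → ℚ.∣ seq x n ∣
  abs-cauchy x ε 0<ε =
    let N , near = cauchy x ε 0<ε
    in N , λ m n ≤m ≤n →
      ℚ.≤-<-trans (dist-∣∣ (seq x m) (seq x n)) (near m n ≤m ≤n)

fromℚ : ℚ → ℝ
fromℚ q = mkℝ (λ _ → q) (const-cauchy q)

fromℤ : ℤ → ℝ
fromℤ i = fromℚ (i ℚ./ 1)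

fromℕ : ℕ → ℝ
fromℕ n = fromℤ (+ n)

0ℝ 1ℝ : ℝ
0ℝ = fromℚ 0ℚ
1ℝ = fromℚ 1ℚ

infixl 6 _+_
infixl 7 _*_
infix  8 -_

_+_ : ℝ → ℝ → ℝ
x + y = mkℝ (λ n → seq x n ℚ.+ seq y n) (+-cauchy x y)

-_ : ℝ → ℝ
- x = mkℝ (λ n → ℚ.- seq x n) (neg-cauchy x)

_*_ : ℝ → ℝ → ℝ
x * y = mkℝ (λ n → seq x n ℚ.* seq y n) (*-cauchy x y)

∣_∣ : ℝ → ℝ
∣ x ∣ = mkℝ (λ n → ℚ.∣ seq x n ∣) (abs-cauchy x)

+-cong : ∀ {x x′ y y′} → x ≈ x′ → y ≈ y′ → x + y ≈ x′ + y′
+-cong {x} {x′} {y} {y′} x≈x′ y≈y′ = mk≈ λ ε 0<ε →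
  let M , near₁ = close x≈x′ (half ε) (half-pos 0<ε)
      N , near₂ = close y≈y′ (half ε) (half-pos 0<ε)
  in M ℕ.⊔ N , λ n ≤n →
    ℚ.≤-<-trans (dist-+ (seq x n) (seq y n) (seq x′ n) (seq y′ n))
      (<half+<half (near₁ n (⊔≤ˡ M N ≤n))
                   (near₂ n (⊔≤ʳ M N ≤n)))

-‿cong : ∀ {x y} → x ≈ y → - x ≈ - y
-‿cong {x} {y} x≈y = mk≈ λ ε 0<ε → let N , near = close x≈y ε 0<ε in
  N , λ n ≤n →
    subst (ℚ._< ε) (sym (dist-neg (seq x n) (seq y n))) (near n ≤n)

*-cong : ∀ {x x′ y y′} → x ≈ x′ → y ≈ y′ → x * y ≈ x′ * y′
*-cong {x} {x′} {y} {y′} x≈x′ y≈y′ = mk≈ λ ε 0<ε →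
  let K , 0<K , L , ≤K = bounded₂ x y′
      0<δ = tolerance-pos 0<ε 0<K
      M , near₁ = close x≈x′ (tolerance ε K) 0<δ
      N , near₂ = close y≈y′ (tolerance ε K) 0<δ
  in L ℕ.⊔ (M ℕ.⊔ N) , λ n ≤n →
    let L≤n = ⊔≤ˡ L (M ℕ.⊔ N) ≤n
        M⊔N≤n = ⊔≤ʳ L (M ℕ.⊔ N) ≤n
    in dist-*-< {p = seq x n} {q = seq y n} {r = seq x′ n} {s = seq y′ n} 0<K
         (proj₁ (≤K n L≤n)) (proj₂ (≤K n L≤n))
         (near₁ n (⊔≤ˡ M N M⊔N≤n))
         (near₂ n (⊔≤ʳ M N M⊔N≤n))

+-*-commutativeRing : CommutativeRing 0ℓ 0ℓ
+-*-commutativeRing = record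
  { Carrier = ℝ
  ; _≈_     = _≈_
  ; _+_     = _+_
  ; _*_     = _*_
  ; -_      = -_
  ; 0#      = 0ℝ
  ; 1#      = 1ℝ
  ; isCommutativeRing = record
    { isRing = record
      { +-isAbelianGroup = record
        { isGroup = record
          { isMonoid = record
            { isSemigroup = record
              { isMagma = record
                { isEquivalence = record
                  { refl  = ≈-refl
                  ; sym   = ≈-sym
                  ; trans = ≈-trans
                  }
                ; ∙-cong = +-cong
                }
              ; assoc = λ x y z → ≗⇒≈
                  λ n → ℚ.+-assoc (seq x n) (seq y n) (seq z n)
              }
            ; identity =
                (λ x → ≗⇒≈ λ n → ℚ.+-identityˡ (seq x n)) ,
                (λ x → ≗⇒≈ λ n → ℚ.+-identityʳ (seq x n))
            }
          ; inverse =
              (λ x → ≗⇒≈ λ n → ℚ.+-inverseˡ (seq x n)) ,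
              (λ x → ≗⇒≈ λ n → ℚ.+-inverseʳ (seq x n))
          ; ⁻¹-cong = -‿cong
          }
        ; comm = λ x y → ≗⇒≈
            λ n → ℚ.+-comm (seq x n) (seq y n)
        }
      ; *-cong = *-cong
      ; *-assoc = λ x y z → ≗⇒≈
          λ n → ℚ.*-assoc (seq x n) (seq y n) (seq z n)
      ; *-identity =
          (λ x → ≗⇒≈ λ n → ℚ.*-identityˡ (seq x n)) ,
          (λ x → ≗⇒≈ λ n → ℚ.*-identityʳ (seq x n))
      ; distrib =
          (λ x y z → ≗⇒≈
            λ n → ℚ.*-distribˡ-+ (seq x n) (seq y n) (seq z n)) ,
          (λ x y z → ≗⇒≈
            λ n → ℚ.*-distribʳ-+ (seq x n) (seq y n) (seq z n))
      }
    ; *-comm = λ x y → ≗⇒≈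
        λ n → ℚ.*-comm (seq x n) (seq y n)
    }
  }

open CommutativeRing +-*-commutativeRing public
  using (_-_; semiring; +-monoid)
open import Algebra.Properties.Semiring.Exp semiring public using (_^_)
open import Algebra.Properties.Monoid.Sum +-monoid public using (sum-syntax)

away-from-0 : ∀ {x} → x # 0ℝ → ∃ λ δ → 0ℚ ℚ.< δ ×
              ∃ λ N → ∀ n → N ℕ.≤ n → δ ℚ.≤ ℚ.∣ seq x n ∣
away-from-0 {x} (inj₁ (mk< δ 0<δ (N , x+δ≤0))) = δ , 0<δ , N , λ n ≤n →
  subst (δ ℚ.≤_) (ℚ.∣-p∣≡∣p∣ (seq x n))
    (ℚ.≤-trans
      (subst (δ ℚ.≤_) (ℚ.+-identityˡ (ℚ.- seq x n))
        (subst (ℚ._≤ 0ℚ ℚ.- seq x n)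
          (solve 2 (λ q d → (q :+ d) :- q := d) refl (seq x n) δ)
          (ℚ.+-monoˡ-≤ (ℚ.- seq x n) (x+δ≤0 n ≤n))))
      (p≤∣p∣ (ℚ.- seq x n)))
away-from-0 {x} (inj₂ (mk< δ 0<δ (N , 0+δ≤x))) = δ , 0<δ , N , λ n ≤n →
  ℚ.≤-trans (subst (ℚ._≤ seq x n) (ℚ.+-identityˡ δ) (0+δ≤x n ≤n))
            (p≤∣p∣ (seq x n))

opaque
  inv-cauchy : ∀ x → x # 0ℝ → IsCauchy λ n → recip (seq x n)
  inv-cauchy x x#0 ε 0<ε =
    let δ , 0<δ , M , δ≤ = away-from-0 x#0
        N , near = cauchy x (δ ℚ.* δ ℚ.* ε) (*-pos (*-pos 0<δ 0<δ) 0<ε)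
    in M ℕ.⊔ N , λ m n ≤m ≤n →
      dist-recip-< {seq x m} {seq x n} 0<δ
        (δ≤ m (⊔≤ˡ M N ≤m)) (δ≤ n (⊔≤ˡ M N ≤n))
        (near m n (⊔≤ʳ M N ≤m) (⊔≤ʳ M N ≤n))

inv : (x : ℝ) → x # 0ℝ → ℝ
inv x x#0 = mkℝ (λ n → recip (seq x n)) (inv-cauchy x x#0)

inv-inverseʳ : ∀ x (x#0 : x # 0ℝ) → x * inv x x#0 ≈ 1ℝ
inv-inverseʳ x x#0 = mk≈ λ ε 0<ε →
  let δ , 0<δ , N , δ≤ = away-from-0 x#0
  in N , λ n ≤n → subst (ℚ._< ε)
    (sym (trans
      (cong (λ q → dist q 1ℚ) (recip-inverseʳ λ x≡0 →
        ℚ.<-irrefl refl (ℚ.<-≤-trans 0<δ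
          (subst (δ ℚ.≤_) (cong ℚ.∣_∣ x≡0) (δ≤ n ≤n)))))
      (dist-refl 1ℚ)))
    0<ε

zpow : (x : ℝ) → x # 0ℝ → ℤ → ℝ
zpow x x#0 (+ n)    = x ^ n
zpow x x#0 -[1+ n ] = inv x x#0 ^ suc n

-- A relation rather than a function ℝ → ℤ: rounding is discontinuous, hence
-- not definable constructively, and has no value at half-integers.
_≡Round[_] : ℤ → ℝ → Set
m ≡Round[ x ] = ∀ j → j ≢ m → ∣ x - fromℤ m ∣ < ∣ x - fromℤ j ∣

-- back k n i is F (n - i).
back : ℕ → ℕ → ℕ → ℤ
back k zero          i       = ℤ.0ℤ
back k (suc zero)    zero    = ℤ.1ℤ
back k (suc (suc n)) zero    = ℤΣ.sum {k} λ i → back k (suc n) (toℕ i)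
back k (suc n)       (suc i) = back k n i

-- The value is 0 at every n ≤ 0, including the n < 2 - k at which the
-- sequence is not defined.
F : ℕ → ℤ → ℤ
F k (+ n)    = back k n 0
F k -[1+ n ] = ℤ.0ℤ

back≡F : ∀ k n i → back k n i ≡ F k (n ⊖ i)
back≡F k zero    zero    = refl
back≡F k zero    (suc i) = refl
back≡F k (suc n) zero    = refl
back≡F k (suc zero)    (suc i) =
  trans (back≡F k 0 i) (cong (F k) (sym (ℤ.[1+m]⊖[1+n]≡m⊖n 0 i)))
back≡F k (suc (suc n)) (suc i) =
  trans (back≡F k (suc n) i) (cong (F k) (sym (ℤ.[1+m]⊖[1+n]≡m⊖n (suc n) i)))

F-zero : ∀ k n → n ℤ.≤ + 0 → F k n ≡ + 0
F-zero k (+ zero) _ = refl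
F-zero k (+ suc n) (ℤ.+≤+ ())
F-zero k -[1+ n ] _ = refl

F-one : ∀ k → F k (+ 1) ≡ + 1
F-one k = refl

F-rec : ∀ k n → + 2 ℤ.≤ n →
        F k n ≡ ℤΣ.sum {k} λ i → F k (n ℤ.- + suc (toℕ i))
F-rec k (+ suc (suc n)) _ = ℤΣ.sum-cong-≗ {k} λ i → trans
  (back≡F k (suc n) (toℕ i))
  (cong (F k) (trans (sym (ℤ.[1+m]⊖[1+n]≡m⊖n (suc n) (toℕ i)))
                     (sym (ℤ.m-n≡m⊖n (suc (suc n)) (suc (toℕ i))))))
F-rec k (+ suc zero) (ℤ.+≤+ (s≤s ()))
F-rec k (+ zero) (ℤ.+≤+ ())

charPoly : ℕ → ℝ → ℝ
charPoly k x = x ^ k - ∑[ i < k ] (x ^ toℕ i)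

denominator : ℕ → ℝ → ℝ
denominator k α = fromℕ 2 + fromℕ (k ℕ.+ 1) * (α - fromℕ 2)

{-# OPTIONS --safe #-}

-- Write r = 1/α. The equation for α says that the weights r, r², …, rᵏ sum to
-- 1, and then that α + rᵏ = 2. Let e n = F n - g αⁿ⁻¹ be the error. Like F and
-- the powers of α it satisfies e (n + 1) = 2 e n - e (n - k), so that
-- e n - ∑ rⁱ⁺¹ e (n - k + i) is multiplied by α when n grows by 1; the choice
-- of g makes it vanish at n = 2. Hence every error is a weighted mean of the k
-- previous ones, and it suffices that the first k lie strictly between -½
-- and ½, that is, that ½ < g < 3/2 and g r < ½. No other root of the
-- polynomial is needed.
module Submission where

open import Defs
open import Algebra.Bundles using (CommutativeRing; Monoid)
import Algebra.Properties.Monoid.Sum as MonoidSum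
open import Algebra.Properties.Semiring.Exp semiring using (^-homo-*)
import Algebra.Solver.Ring
import Algebra.Solver.Ring.AlmostCommutativeRing as ACR
open import Data.Fin.Base using (toℕ)
open import Data.Integer.Base as ℤ using (ℤ; +_)
import Data.Integer.Properties as ℤ
open import Data.Integer.Solver using () renaming (module +-*-Solver to ℤS)
open import Data.Maybe.Base using (Maybe; just; nothing)
open import Data.Nat.Base as ℕ using (ℕ; zero; suc)
import Data.Nat.Properties as ℕ
open import Data.Product.Base using (_×_; _,_; proj₁; proj₂; Σ-syntax)
open import Data.Rational.Base as ℚ using (ℚ; 0ℚ; 1ℚ; ½)
import Data.Rational.Properties as ℚ
open import Data.Rational.Solver using () renaming (module +-*-Solver to ℚS)
import Data.Rational.Unnormalised.Base as ℚᵘ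
import Data.Rational.Unnormalised.Properties as ℚᵘ
open import Data.Sum.Base using (_⊎_; inj₁; inj₂)
open import Function.Base using (_∘_)
open import Relation.Binary.Definitions using (tri<; tri≈; tri>)
open import Relation.Binary.PropositionalEquality
  using (_≡_; refl; sym; trans; cong; cong₂; subst; subst₂)
open import Relation.Nullary.Decidable.Core using (yes; no; toWitness)
open import Relation.Nullary.Negation.Core using (¬_; contradiction)

private module R = CommutativeRing +-*-commutativeRing

-- Ring identities over the reals with rational coefficients.

ℝ-ring : ACR.AlmostCommutativeRing _ _
ℝ-ring = ACR.fromCommutativeRing +-*-commutativeRing

fromℚ-morphism : CommutativeRing.rawRing ℚ.+-*-commutativeRing
                 ACR.-Raw-AlmostCommutative⟶ ℝ-ring
fromℚ-morphism = record
  { ⟦_⟧    = fromℚ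
  ; +-homo = λ _ _ → ≗⇒≈ λ _ → refl
  ; *-homo = λ _ _ → ≗⇒≈ λ _ → refl
  ; -‿homo = λ _ → ≗⇒≈ λ _ → refl
  ; 0-homo = ≈-refl
  ; 1-homo = ≈-refl
  }

fromℚ-≟ : ∀ p q → Maybe (fromℚ p ≈ fromℚ q)
fromℚ-≟ p q with p ℚ.≟ q
... | yes refl = just ≈-refl
... | no _     = nothing

open Algebra.Solver.Ring _ ℝ-ring fromℚ-morphism fromℚ-≟

-- x ≈ y follows from equations lᵢ ≈ rᵢ by a ring identity x - y = ∑ cᵢ * (lᵢ - rᵢ).
linear : ∀ {x y e} → e ≈ 0ℝ → x - y ≈ e → x ≈ y
linear {x} {y} {e} e≈0 x-y≈e = R.trans
  (solve 2 (λ x y → x := (x :- y) :+ y) ≈-refl x y)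
  (R.trans (+-cong (R.trans x-y≈e e≈0) ≈-refl) (R.+-identityˡ y))

infixl 6 _⊕_
infix  7 _·_

-- Together with `_⊕_` this builds the combination that `linear` consumes: `c₁ · p₁ ⊕ c₂ · p₂` for
-- equations `p₁` and `p₂`.
_·_ : ∀ c {x y} → x ≈ y → c * (x - y) ≈ 0ℝ
_·_ c {x} {y} x≈y = R.trans (*-cong ≈-refl (+-cong x≈y ≈-refl))
  (solve 2 (λ c y → c :* (y :- y) := con 0ℚ) ≈-refl c y)

_⊕_ : ∀ {x y} → x ≈ 0ℝ → y ≈ 0ℝ → x + y ≈ 0ℝ
x≈0 ⊕ y≈0 = R.trans (+-cong x≈0 y≈0) (R.+-identityˡ 0ℝ)

-- The strict order on the reals.

0<-intro : ∀ {x} δ → 0ℚ ℚ.< δ → ∀ N →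
           (∀ n → N ℕ.≤ n → δ ℚ.≤ seq x n) → 0ℝ < x
0<-intro {x} δ 0<δ N δ≤x = mk< δ 0<δ (N , λ n N≤n →
  subst (ℚ._≤ seq x n) (sym (ℚ.+-identityˡ δ)) (δ≤x n N≤n))

0<-elim : ∀ {x} ((mk< δ _ (N , _)) : 0ℝ < x) →
          ∀ n → N ℕ.≤ n → δ ℚ.≤ seq x n
0<-elim {x} (mk< δ _ (N , δ≤x)) n N≤n =
  subst (ℚ._≤ seq x n) (ℚ.+-identityˡ δ) (δ≤x n N≤n)

-- Eventually x and y differ by less than half the margin of x, so the other half remains as a
-- margin for y.
0<-resp-≈ : ∀ {x y} → x ≈ y → 0ℝ < x → 0ℝ < y
0<-resp-≈ {x} {y} x≈y 0<x@(mk< δ 0<δ (M , _)) =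
  let N , near = close x≈y (half δ) (half-pos 0<δ)
  in 0<-intro (half δ) (half-pos 0<δ) (M ℕ.⊔ N) λ n ≤n →
    subst₂ ℚ._≤_
      (trans (cong (ℚ._- half δ) (sym (half+half δ)))
             (ℚS.solve 1 (λ h → (h ℚS.:+ h) ℚS.:- h ℚS.:= h) refl (half δ)))
      (ℚS.solve 2 (λ p q → p ℚS.:- (p ℚS.:- q) ℚS.:= q) refl (seq x n) (seq y n))
      (ℚ.+-mono-≤ (0<-elim 0<x n (⊔≤ˡ M N ≤n))
        (ℚ.neg-antimono-≤ (ℚ.≤-trans (p≤∣p∣ (seq x n ℚ.- seq y n))
          (ℚ.<⇒≤ (near n (⊔≤ʳ M N ≤n))))))

0<+ : ∀ {x y} → 0ℝ < x → 0ℝ < y → 0ℝ < x + y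
0<+ 0<x@(mk< δ 0<δ (M , _)) 0<y@(mk< ε 0<ε (N , _)) =
  0<-intro (δ ℚ.+ ε) (+-pos 0<δ (ℚ.<⇒≤ 0<ε)) (M ℕ.⊔ N) λ n ≤n →
    ℚ.+-mono-≤ (0<-elim 0<x n (⊔≤ˡ M N ≤n)) (0<-elim 0<y n (⊔≤ʳ M N ≤n))

0<* : ∀ {x y} → 0ℝ < x → 0ℝ < y → 0ℝ < x * y
0<* {x} {y} 0<x@(mk< δ 0<δ (M , _)) 0<y@(mk< ε 0<ε (N , _)) =
  0<-intro (δ ℚ.* ε) (*-pos 0<δ 0<ε) (M ℕ.⊔ N) λ n ≤n →
    let δ≤x = 0<-elim 0<x n (⊔≤ˡ M N ≤n)
        ε≤y = 0<-elim 0<y n (⊔≤ʳ M N ≤n)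
    in ℚ.≤-trans (*-monoˡ-≤ (ℚ.<⇒≤ 0<δ) ε≤y)
         (*-monoʳ-≤ (ℚ.<⇒≤ (ℚ.<-≤-trans 0<ε ε≤y)) δ≤x)

0<fromℚ : ∀ {q} → 0ℚ ℚ.< q → 0ℝ < fromℚ q
0<fromℚ {q} 0<q = 0<-intro q 0<q 0 λ _ _ → ℚ.≤-refl

0<-irrefl : ¬ 0ℝ < 0ℝ
0<-irrefl 0<0@(mk< δ 0<δ (N , _)) =
  ℚ.<-irrefl refl (ℚ.<-≤-trans 0<δ (0<-elim 0<0 N ℕ.≤-refl))

<⇒0<- : ∀ {x y} → x < y → 0ℝ < y - x
<⇒0<- {x} {y} (mk< δ 0<δ (N , x+δ≤y)) = 0<-intro δ 0<δ N λ n N≤n →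
  subst (ℚ._≤ seq y n ℚ.- seq x n)
    (ℚS.solve 2 (λ p d → (p ℚS.:+ d) ℚS.:- p ℚS.:= d) refl (seq x n) δ)
    (ℚ.+-monoˡ-≤ (ℚ.- seq x n) (x+δ≤y n N≤n))

0<-⇒< : ∀ {x y} → 0ℝ < y - x → x < y
0<-⇒< {x} {y} 0<y-x@(mk< δ 0<δ (N , _)) = mk< δ 0<δ (N , λ n N≤n →
  subst (seq x n ℚ.+ δ ℚ.≤_)
    (ℚS.solve 2 (λ p q → p ℚS.:+ (q ℚS.:- p) ℚS.:= q) refl (seq x n) (seq y n))
    (ℚ.+-monoʳ-≤ (seq x n) (0<-elim 0<y-x n N≤n)))

-- The standard form of the estimates below: e is an expression built from positive parts, and a
-- ring identity equates it with the difference.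
<-from-difference : ∀ {x y e} → 0ℝ < e → e ≈ y - x → x < y
<-from-difference 0<e e≈y-x = 0<-⇒< (0<-resp-≈ e≈y-x 0<e)

<-trans : ∀ {x y z} → x < y → y < z → x < z
<-trans {x} {y} {z} x<y y<z = <-from-difference (0<+ (<⇒0<- x<y) (<⇒0<- y<z))
  (solve 3 (λ x y z → (y :- x) :+ (z :- y) := z :- x) ≈-refl x y z)

<-resp-≈ : ∀ {x x′ y y′} → x ≈ x′ → y ≈ y′ → x < y → x′ < y′
<-resp-≈ x≈x′ y≈y′ x<y =
  <-from-difference (<⇒0<- x<y) (+-cong y≈y′ (-‿cong x≈x′))

+-mono-< : ∀ {x x′ y y′} → x < x′ → y < y′ → x + y < x′ + y′
+-mono-< {x} {x′} {y} {y′} x<x′ y<y′ =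
  <-from-difference (0<+ (<⇒0<- x<x′) (<⇒0<- y<y′))
    (solve 4 (λ x x′ y y′ → (x′ :- x) :+ (y′ :- y) := (x′ :+ y′) :- (x :+ y))
      ≈-refl x x′ y y′)

+-monoˡ-< : ∀ z {x y} → x < y → x + z < y + z
+-monoˡ-< z {x} {y} x<y = <-from-difference (<⇒0<- x<y)
  (solve 3 (λ x y z → y :- x := (y :+ z) :- (x :+ z)) ≈-refl x y z)

*-monoʳ-< : ∀ {x y z} → 0ℝ < z → x < y → z * x < z * y
*-monoʳ-< {x} {y} {z} 0<z x<y = <-from-difference (0<* 0<z (<⇒0<- x<y))
  (solve 3 (λ x y z → z :* (y :- x) := z :* y :- z :* x) ≈-refl x y z)

-- Once x varies by less than a quarter of q - p, a single term decides.
<-cotrans : ∀ {p q} → p ℚ.< q → ∀ x → fromℚ p < x ⊎ x < fromℚ q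
<-cotrans {p} {q} p<q x = decide (ℚ.≤-total (p ℚ.+ (ε ℚ.+ ε)) (seq x N))
  where
  ε = (+ 1 ℚ./ 4) ℚ.* (q ℚ.- p)

  0<ε : 0ℚ ℚ.< ε
  0<ε = *-pos (ℚ.positive⁻¹ (+ 1 ℚ./ 4))
    (subst (ℚ._< q ℚ.- p) (ℚ.+-inverseʳ p) (ℚ.+-monoˡ-< (ℚ.- p) p<q))

  N = proj₁ (cauchy x ε 0<ε)

  near : ∀ m n → N ℕ.≤ m → N ℕ.≤ n → seq x m ℚ.- seq x n ℚ.≤ ε
  near m n N≤m N≤n = ℚ.≤-trans (p≤∣p∣ (seq x m ℚ.- seq x n))
    (ℚ.<⇒≤ (proj₂ (cauchy x ε 0<ε) m n N≤m N≤n))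

  decide : p ℚ.+ (ε ℚ.+ ε) ℚ.≤ seq x N ⊎ seq x N ℚ.≤ p ℚ.+ (ε ℚ.+ ε) →
           fromℚ p < x ⊎ x < fromℚ q
  decide (inj₁ ≤xN) = inj₁ (mk< ε 0<ε (N , λ n N≤n → subst₂ ℚ._≤_
    (ℚS.solve 2 (λ p e → (p ℚS.:+ (e ℚS.:+ e)) ℚS.:- e ℚS.:= p ℚS.:+ e) refl p ε)
    (ℚS.solve 2 (λ a b → a ℚS.:- (a ℚS.:- b) ℚS.:= b) refl (seq x N) (seq x n))
    (ℚ.+-mono-≤ ≤xN (ℚ.neg-antimono-≤ (near N n ℕ.≤-refl N≤n)))))
  decide (inj₂ xN≤) = inj₂ (mk< ε 0<ε (N , λ n N≤n → subst₂ ℚ._≤_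
    (ℚS.solve 3 (λ a b e → (a ℚS.:+ (b ℚS.:- a)) ℚS.:+ e ℚS.:= b ℚS.:+ e) refl
      (seq x N) (seq x n) ε)
    (ℚS.solve 2 (λ p q → let e = ℚS.con (+ 1 ℚ./ 4) ℚS.:* (q ℚS.:- p) in
        ((p ℚS.:+ (e ℚS.:+ e)) ℚS.:+ e) ℚS.:+ e ℚS.:= q) refl p q)
    (ℚ.+-monoˡ-≤ ε (ℚ.+-mono-≤ xN≤ (near n N N≤n ℕ.≤-refl)))))

-- The margin must be uniform in n; an eventual upper bound K of x supplies 1/K.
0<inv : ∀ {x} (0<x : 0ℝ < x) → 0ℝ < inv x (inj₂ 0<x)
0<inv {x} 0<x@(mk< δ 0<δ (M , _)) =
  let K , 0<K , N , x≤K = bounded x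
  in 0<-intro (recip K) (recip-pos 0<K) (M ℕ.⊔ N) λ n ≤n →
    let 0<xn = ℚ.<-≤-trans 0<δ (0<-elim 0<x n (⊔≤ˡ M N ≤n))
    in ℚ.*-cancelˡ-≤-pos K {{ℚ.positive 0<K}}
         (subst (ℚ._≤ K ℚ.* recip (seq x n))
           (trans (recip-inverseʳ (pos⇒≢0 0<xn)) (sym (recip-inverseʳ (pos⇒≢0 0<K))))
           (*-monoʳ-≤ (ℚ.<⇒≤ (recip-pos 0<xn))
             (ℚ.≤-trans (p≤∣p∣ (seq x n)) (x≤K n (⊔≤ʳ M N ≤n)))))

-- The integers among the reals.

-- Normalisation of fractions blocks computation at variable i and j; among the unnormalised
-- rationals both sides have denominator 1.
/1-homo-+ : ∀ i j → (i ℤ.+ j) ℚ./ 1 ≡ i ℚ./ 1 ℚ.+ j ℚ./ 1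
/1-homo-+ i j = ℚ.toℚᵘ-injective (begin
  ℚ.toℚᵘ ((i ℤ.+ j) ℚ./ 1)
    ≈⟨ ℚ.toℚᵘ-fromℚᵘ (ℚᵘ.mkℚᵘ (i ℤ.+ j) 0) ⟩
  ℚᵘ.mkℚᵘ (i ℤ.+ j) 0
    ≈⟨ ℚᵘ.*≡* (cong (ℤ._* + 1)
         (cong₂ ℤ._+_ (sym (ℤ.*-identityʳ i)) (sym (ℤ.*-identityʳ j)))) ⟩
  ℚᵘ.mkℚᵘ i 0 ℚᵘ.+ ℚᵘ.mkℚᵘ j 0
    ≈⟨ ℚᵘ.+-cong (ℚ.toℚᵘ-fromℚᵘ (ℚᵘ.mkℚᵘ i 0)) (ℚ.toℚᵘ-fromℚᵘ (ℚᵘ.mkℚᵘ j 0)) ⟨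
  ℚ.toℚᵘ (i ℚ./ 1) ℚᵘ.+ ℚ.toℚᵘ (j ℚ./ 1)
    ≈⟨ ℚ.toℚᵘ-homo-+ (i ℚ./ 1) (j ℚ./ 1) ⟨
  ℚ.toℚᵘ (i ℚ./ 1 ℚ.+ j ℚ./ 1) ∎)
  where open import Relation.Binary.Reasoning.Setoid ℚᵘ.≃-setoid

fromℤ-homo-+ : ∀ i j → fromℤ (i ℤ.+ j) ≈ fromℤ i + fromℤ j
fromℤ-homo-+ i j = ≗⇒≈ λ _ → /1-homo-+ i j

fromℕ-suc : ∀ n → fromℕ (suc n) ≈ 1ℝ + fromℕ n
fromℕ-suc n = fromℤ-homo-+ (+ 1) (+ n)

0<+fromℕ : ∀ {x} n → 0ℝ < x → 0ℝ < x + fromℕ n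
0<+fromℕ {x} zero    0<x = 0<-resp-≈ (R.sym (R.+-identityʳ x)) 0<x
0<+fromℕ {x} (suc n) 0<x = 0<-resp-≈
  (R.trans (R.+-assoc x 1ℝ (fromℕ n)) (+-cong ≈-refl (R.sym (fromℕ-suc n))))
  (0<+fromℕ n (0<+ 0<x (0<fromℚ 0<1)))

0<fromℕ-suc : ∀ n → 0ℝ < fromℕ (suc n)
0<fromℕ-suc n = 0<-resp-≈ (R.sym (fromℕ-suc n)) (0<+fromℕ n (0<fromℚ 0<1))

i≤j⇒j≡i+n : ∀ {i j} → i ℤ.≤ j → Σ[ n ∈ ℕ ] j ≡ i ℤ.+ + n
i≤j⇒j≡i+n {i} {j} i≤j with j ℤ.- i in eq | ℤ.i≤j⇒0≤j-i i≤j
... | + n | _ = n , trans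
  (ℤS.solve 2 (λ i j → j ℤS.:= i ℤS.:+ (j ℤS.:- i)) refl i j)
  (cong (λ d → i ℤ.+ d) eq)

i<j⇒j≡i+suc : ∀ {i j} → i ℤ.< j → Σ[ n ∈ ℕ ] j ≡ i ℤ.+ + suc n
i<j⇒j≡i+suc {i} i<j with n , j≡ ← i≤j⇒j≡i+n (ℤ.i<j⇒suc[i]≤j i<j) = n , trans j≡
  (ℤS.solve 2 (λ i n → (ℤS.con (+ 1) ℤS.:+ i) ℤS.:+ n
    ℤS.:= i ℤS.:+ (ℤS.con (+ 1) ℤS.:+ n)) refl i (+ n))

-- Absolute values and rounding.

∣∣-< : ∀ {x c} → x < c → - x < c → ∣ x ∣ < c
∣∣-< {x} {c} (mk< δ 0<δ (M , x+δ≤c)) (mk< ε 0<ε (N , -x+ε≤c)) =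
  -- The sign of `seq x n` may vary with n, so the margin has to serve both signs.
  mk< (δ ℚ.⊓ ε) 0<δ⊓ε (M ℕ.⊔ N , bound)
  where
  0<δ⊓ε : 0ℚ ℚ.< δ ℚ.⊓ ε
  0<δ⊓ε with ℚ.⊓-sel δ ε
  ... | inj₁ eq = subst (0ℚ ℚ.<_) (sym eq) 0<δ
  ... | inj₂ eq = subst (0ℚ ℚ.<_) (sym eq) 0<ε

  bound : ∀ n → M ℕ.⊔ N ℕ.≤ n → ℚ.∣ seq x n ∣ ℚ.+ (δ ℚ.⊓ ε) ℚ.≤ seq c n
  bound n ≤n with ℚ.∣p∣≡p∨∣p∣≡-p (seq x n)
  ... | inj₁ eq = ℚ.≤-trans (ℚ.+-mono-≤ (ℚ.≤-reflexive eq) (ℚ.p⊓q≤p δ ε))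
                            (x+δ≤c n (⊔≤ˡ M N ≤n))
  ... | inj₂ eq = ℚ.≤-trans (ℚ.+-mono-≤ (ℚ.≤-reflexive eq) (ℚ.p⊓q≤q δ ε))
                            (-x+ε≤c n (⊔≤ʳ M N ≤n))

<-∣∣ : ∀ {x c} → c < x → c < ∣ x ∣
<-∣∣ {x} (mk< δ 0<δ (N , c+δ≤x)) = mk< δ 0<δ (N , λ n N≤n →
  ℚ.≤-trans (c+δ≤x n N≤n) (p≤∣p∣ (seq x n)))

<-∣-∣ : ∀ {x c} → c < - x → c < ∣ x ∣
<-∣-∣ {x} c<-x = <-resp-≈ ≈-refl (≗⇒≈ λ n → ℚ.∣-p∣≡∣p∣ (seq x n)) (<-∣∣ c<-x)

½ℝ : ℝ
½ℝ = fromℚ ½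

0<½ : 0ℝ < ½ℝ
0<½ = 0<fromℚ (ℚ.positive⁻¹ ½)

-- The number ½ separates the two distances: any other integer is n + 1 away from m for some natural
-- n, hence more than n + ½ away from x.
within-½⇒Round : ∀ {m x} → - ½ℝ < fromℤ m - x → fromℤ m - x < ½ℝ → m ≡Round[ x ]
within-½⇒Round {m} {x} -½<m-x m-x<½ j j≢m = <-trans
  (∣∣-<
    (<-from-difference (<⇒0<- -½<m-x)
      (solve 2 (λ m x → (m :- x) :- :- con ½ := con ½ :- (x :- m)) ≈-refl (fromℤ m) x))
    (<-from-difference (<⇒0<- m-x<½)
      (solve 2 (λ m x → con ½ :- (m :- x) := con ½ :- :- (x :- m)) ≈-refl (fromℤ m) x)))
  far
  where
  far : ½ℝ < ∣ x - fromℤ j ∣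
  far with ℤ.<-cmp j m
  ... | tri≈ _ j≡m _ = contradiction j≡m j≢m
  ... | tri< j<m _ _ with n , refl ← i<j⇒j≡i+suc j<m = <-∣∣
    (<-from-difference (0<+fromℕ n (<⇒0<- m-x<½))
      (linear (- 1ℝ · fromℤ-homo-+ j (+ suc n) ⊕ - 1ℝ · fromℕ-suc n)
        (solve 5 (λ x j n m N →
          (con ½ :- (m :- x) :+ n) :- ((x :- j) :- con ½)
            := :- con 1ℚ :* (m :- (j :+ N)) :+ :- con 1ℚ :* (N :- (con 1ℚ :+ n)))
          ≈-refl x (fromℤ j) (fromℕ n) (fromℤ m) (fromℕ (suc n)))))
  ... | tri> _ _ m<j with n , refl ← i<j⇒j≡i+suc m<j = <-∣-∣
    (<-from-difference (0<+fromℕ n (<⇒0<- -½<m-x))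
      (linear (- 1ℝ · fromℤ-homo-+ m (+ suc n) ⊕ - 1ℝ · fromℕ-suc n)
        (solve 5 (λ x j n m N →
          ((m :- x) :- :- con ½ :+ n) :- (:- (x :- j) :- con ½)
            := :- con 1ℚ :* (j :- (m :+ N)) :+ :- con 1ℚ :* (N :- (con 1ℚ :+ n)))
          ≈-refl x (fromℤ j) (fromℕ n) (fromℤ m) (fromℕ (suc n)))))

-- Finite sums and discounted sums.

module _ {c ℓ} (M : Monoid c ℓ) where
  open Monoid M using (Carrier; _∙_; identityˡ; identityʳ; ∙-congˡ; assoc)
    renaming (_≈_ to _≈ₘ_; sym to ≈ₘ-sym; trans to ≈ₘ-trans)
  open MonoidSum M using (sum)

  -- The sum unfolds at its first term, whereas moving a window also needs the last one. The monoid
  -- is arbitrary because both integer and real sums occur.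
  sum-toℕ-last : ∀ (f : ℕ → Carrier) n →
    sum {suc n} (λ i → f (toℕ i)) ≈ₘ sum {n} (λ i → f (toℕ i)) ∙ f n
  sum-toℕ-last f zero    = ≈ₘ-trans (identityʳ (f 0)) (≈ₘ-sym (identityˡ (f 0)))
  sum-toℕ-last f (suc n) = ≈ₘ-trans
    (∙-congˡ (sum-toℕ-last (λ i → f (suc i)) n))
    (≈ₘ-sym (assoc (f 0) _ _))

-- ∑[ i < k ] r ^ suc i * e i, in Horner form.
discount : ℝ → ℕ → (ℕ → ℝ) → ℝ
discount r zero    e = 0ℝ
discount r (suc k) e = r * (e 0 + discount r k (e ∘ suc))

module _ (r : ℝ) where

  discount-0 : ∀ k e → (∀ i → i ℕ.< k → e i ≈ 0ℝ) → discount r k e ≈ 0ℝ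
  discount-0 zero    e e≈0 = ≈-refl
  discount-0 (suc k) e e≈0 = R.trans
    (*-cong ≈-refl (e≈0 0 ℕ.z<s ⊕
      discount-0 k (e ∘ suc) λ i i<k → e≈0 (suc i) (ℕ.s<s i<k)))
    (R.zeroʳ r)

  discount-const : ∀ k c → discount r k (λ _ → c) ≈ c * discount r k (λ _ → 1ℝ)
  discount-const zero    c = R.sym (R.zeroʳ c)
  discount-const (suc k) c = linear (r · discount-const k c)
    (solve 4 (λ r c d d₁ → r :* (c :+ d) :- c :* (r :* (con 1ℚ :+ d₁))
      := r :* (d :- c :* d₁)) ≈-refl r c
        (discount r k λ _ → c) (discount r k λ _ → 1ℝ))

  discount-- : ∀ k x y →
    discount r k (λ i → x i - y i) ≈ discount r k x - discount r k y
  discount-- zero    x y = solve 0 (con 0ℚ := con 0ℚ :- con 0ℚ) ≈-refl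
  discount-- (suc k) x y = linear (r · discount-- k (x ∘ suc) (y ∘ suc))
    (solve 6 (λ r x y d dx dy →
      r :* ((x :- y) :+ d) :- (r :* (x :+ dx) :- r :* (y :+ dy))
        := r :* (d :- (dx :- dy))) ≈-refl r (x 0) (y 0)
        (discount r k λ i → x (suc i) - y (suc i))
        (discount r k (x ∘ suc)) (discount r k (y ∘ suc)))

  discount-last : ∀ k e → discount r (suc k) e ≈ discount r k e + r ^ suc k * e k
  discount-last zero    e = solve 2
    (λ r e → r :* (e :+ con 0ℚ) := con 0ℚ :+ r :* con 1ℚ :* e) ≈-refl r (e 0)
  discount-last (suc k) e = linear (r · discount-last k (e ∘ suc))
    (solve 6 (λ r e₀ d d′ p eₖ →
      r :* (e₀ :+ d) :- (r :* (e₀ :+ d′) :+ r :* p :* eₖ)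
        := r :* (d :- (d′ :+ p :* eₖ))) ≈-refl r (e 0)
        (discount r (suc k) (e ∘ suc)) (discount r k (e ∘ suc))
        (r ^ suc k) (e (suc k)))

  discount-mono-< : 0ℝ < r → ∀ k {x y} → (∀ i → i ℕ.< suc k → x i < y i) →
                    discount r (suc k) x < discount r (suc k) y
  discount-mono-< 0<r zero    x<y = *-monoʳ-< 0<r (+-monoˡ-< 0ℝ (x<y 0 ℕ.z<s))
  discount-mono-< 0<r (suc k) x<y = *-monoʳ-< 0<r
    (+-mono-< (x<y 0 ℕ.z<s) (discount-mono-< 0<r k λ i i<k → x<y (suc i) (ℕ.s<s i<k)))

  -- The empty sum is zero and every other one is positive. The disjunction expresses nonnegativity
  -- by means of the strict order alone.
  discount-1-nonNeg : 0ℝ < r → ∀ k →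
    discount r k (λ _ → 1ℝ) ≈ 0ℝ ⊎ 0ℝ < discount r k (λ _ → 1ℝ)
  discount-1-nonNeg 0<r zero    = inj₁ ≈-refl
  discount-1-nonNeg 0<r (suc k) = inj₂ (<-resp-≈
    (discount-0 (suc k) (λ _ → 0ℝ) λ _ _ → ≈-refl) ≈-refl
    (discount-mono-< 0<r k λ _ _ → 0<fromℚ 0<1))

-- Weights given by the powers of r = 1/α.

module _ (α r : ℝ) (αr≈1 : α * r ≈ 1ℝ) where

  ^-inverse : ∀ n → r ^ n * α ^ n ≈ 1ℝ
  ^-inverse zero    = R.*-identityˡ 1ℝ
  ^-inverse (suc n) = linear ((r ^ n * α ^ n) · αr≈1 ⊕ 1ℝ · ^-inverse n)
    (solve 4 (λ r α rⁿ αⁿ → (r :* rⁿ) :* (α :* αⁿ) :- con 1ℚ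
      := rⁿ :* αⁿ :* (α :* r :- con 1ℚ) :+ con 1ℚ :* (rⁿ :* αⁿ :- con 1ℚ))
      ≈-refl r α (r ^ n) (α ^ n))

  -- Each of the k terms rⁱ⁺¹ c αⁱ equals c r.
  discount-geometric : ∀ k c e → (∀ i → e i ≈ c * α ^ i) →
                       discount r k e ≈ fromℕ k * (c * r)
  discount-geometric zero    c e e≈ = R.sym (R.zeroˡ (c * r))
  discount-geometric (suc k) c e e≈ = linear
    (r · e≈ 0 ⊕ r · IH ⊕ (fromℕ k * c * r) · αr≈1 ⊕ (- (c * r)) · fromℕ-suc k)
    (solve 7 (λ r α c e₀ d K K′ →
      r :* (e₀ :+ d) :- K′ :* (c :* r)
        := r :* (e₀ :- c :* con 1ℚ) :+ r :* (d :- K :* (c :* α :* r))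
           :+ K :* c :* r :* (α :* r :- con 1ℚ)
           :+ :- (c :* r) :* (K′ :- (con 1ℚ :+ K)))
      ≈-refl r α c (e 0) (discount r k (e ∘ suc)) (fromℕ k) (fromℕ (suc k)))
    where
    IH = discount-geometric k (c * α) (e ∘ suc) λ i →
      R.trans (e≈ (suc i)) (R.sym (R.*-assoc c α (α ^ i)))

  -- Multiplication by αᵏ turns r, r², ..., rᵏ into the powers αᵏ⁻¹, ..., α, 1, the same sum in
  -- reverse order.
  power-sum : ∀ k → α ^ k * discount r k (λ _ → 1ℝ) ≈ ∑[ i < k ] (α ^ toℕ i)
  power-sum zero    = R.zeroʳ 1ℝ
  power-sum (suc k) = linear
    ((α ^ k * (1ℝ + w)) · αr≈1 ⊕ 1ℝ · power-sum k
      ⊕ (- 1ℝ) · sum-toℕ-last +-monoid (α ^_) k)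
    (solve 6 (λ α r p w S S′ →
      α :* p :* (r :* (con 1ℚ :+ w)) :- S′
        := p :* (con 1ℚ :+ w) :* (α :* r :- con 1ℚ) :+ con 1ℚ :* (p :* w :- S)
           :+ :- con 1ℚ :* (S′ :- (S :+ p)))
      ≈-refl α r (α ^ k) w (∑[ i < k ] (α ^ toℕ i)) (∑[ i < suc k ] (α ^ toℕ i)))
    where w = discount r k λ _ → 1ℝ

  -- This is the equation for α divided by αᵏ.
  discount-1 : ∀ k → charPoly k α ≈ 0ℝ → discount r k (λ _ → 1ℝ) ≈ 1ℝ
  discount-1 k root = linear
    ((1ℝ - w) · ^-inverse k ⊕ r ^ k · power-sum k ⊕ (- r ^ k) · root)
    (solve 4 (λ p q w S →
      w :- con 1ℚ
        := (con 1ℚ :- w) :* (q :* p :- con 1ℚ) :+ q :* (p :* w :- S)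
           :+ :- q :* ((p :- S) :- con 0ℚ))
      ≈-refl (α ^ k) (r ^ k) w (∑[ i < k ] (α ^ toℕ i)))
    where w = discount r k λ _ → 1ℝ

  -- Multiplying r + ... + rᵏ = 1 by α gives 1 + r + ... + rᵏ⁻¹ = α, and the left side is 1 + (1 -
  -- rᵏ).
  α+rᵏ≈2 : ∀ m → discount r (suc m) (λ _ → 1ℝ) ≈ 1ℝ → α + r ^ suc m ≈ fromℕ 2
  α+rᵏ≈2 m total = linear
    ((- 1ℝ) · discount-last r m (λ _ → 1ℝ) ⊕ (1ℝ - α) · total ⊕ (1ℝ + w) · αr≈1)
    (solve 4 (λ α r p w →
      α :+ p :- con (+ 2 ℚ./ 1)
        := :- con 1ℚ :* (r :* (con 1ℚ :+ w) :- (w :+ p :* con 1ℚ))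
           :+ (con 1ℚ :- α) :* (r :* (con 1ℚ :+ w) :- con 1ℚ)
           :+ (con 1ℚ :+ w) :* (α :* r :- con 1ℚ))
      ≈-refl α r (r ^ suc m) w)
    where w = discount r m λ _ → 1ℝ

-- r + r² ≤ 1 excludes r > 5/8, as 5/8 exceeds the root of r + r² = 1.
r<⅔ : ∀ {r} → 0ℝ < r → ∀ m → discount r (2 ℕ.+ m) (λ _ → 1ℝ) ≈ 1ℝ →
      r < fromℚ (+ 2 ℚ./ 3)
r<⅔ {r} 0<r m total
  with <-cotrans {+ 5 ℚ./ 8} {+ 2 ℚ./ 3} (toWitness {a? = (+ 5 ℚ./ 8) ℚ.<? (+ 2 ℚ./ 3)} _) r
... | inj₂ r<⅔ = r<⅔
... | inj₁ ⅝<r = contradiction (0<-resp-≈ ≈0 (0<+ (0<+ 0<E (0<* 0<s 0<s))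
                                (0<* (0<fromℚ (ℚ.positive⁻¹ (+ 9 ℚ./ 4))) 0<s))) 0<-irrefl
  where
  w = discount r m λ _ → 1ℝ
  s = r - fromℚ (+ 5 ℚ./ 8)

  0<s : 0ℝ < s
  0<s = <⇒0<- ⅝<r

  0<E : 0ℝ < fromℚ (+ 1 ℚ./ 64) + w * (r * r)
  0<E with discount-1-nonNeg r 0<r m
  ... | inj₁ w≈0 = 0<-resp-≈ (linear ((- (r * r)) · w≈0)
        (solve 2 (λ r w → con (+ 1 ℚ./ 64) :- (con (+ 1 ℚ./ 64) :+ w :* (r :* r))
          := :- (r :* r) :* (w :- con 0ℚ)) ≈-refl r w))
        (0<fromℚ (ℚ.positive⁻¹ (+ 1 ℚ./ 64)))
  ... | inj₂ 0<w = 0<+ (0<fromℚ (ℚ.positive⁻¹ (+ 1 ℚ./ 64))) (0<* 0<w (0<* 0<r 0<r))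

  -- The polynomial r² + r - 1 is expanded at 5/8, where its value is 1/64 and its slope 9/4;
  -- `w * (r * r)` collects the weights from r³ on.
  ≈0 : fromℚ (+ 1 ℚ./ 64) + w * (r * r) + s * s + fromℚ (+ 9 ℚ./ 4) * s ≈ 0ℝ
  ≈0 = linear (1ℝ · total)
    (solve 2 (λ r w → let s = r :- con (+ 5 ℚ./ 8) in
      con (+ 1 ℚ./ 64) :+ w :* (r :* r) :+ s :* s :+ con (+ 9 ℚ./ 4) :* s :- con 0ℚ
        := con 1ℚ :* (r :* (con 1ℚ :+ r :* (con 1ℚ :+ w)) :- con 1ℚ))
      ≈-refl r w)

-- Propagation of bounds by weighted means.

module _ {α r : ℝ} (αr≈1 : α * r ≈ 1ℝ) (0<r : 0ℝ < r) (m : ℕ)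
         (total : discount r (suc m) (λ _ → 1ℝ) ≈ 1ℝ) where

  -- With k = m + 1 and d the discounted sum of e 1, ..., e m, the recurrence and α + rᵏ = 2 give
  -- the new defect as α eₖ - (e₀ + d). This is α times the old defect eₖ - r (e₀ + d), which is
  -- zero.
  discount-step : ∀ e → e (2 ℕ.+ m) ≈ fromℕ 2 * e (suc m) - e 0 →
                  e (suc m) ≈ discount r (suc m) e →
                  e (2 ℕ.+ m) ≈ discount r (suc m) (e ∘ suc)
  discount-step e rec balanced = linear
    (1ℝ · rec ⊕ (- 1ℝ) · discount-last r m (e ∘ suc) ⊕ (- e (suc m)) · α+rᵏ≈2 α r αr≈1 m total
      ⊕ α · balanced ⊕ (e 0 + discount r m (e ∘ suc)) · αr≈1)
    (solve 8 (λ α r p e₀ eₖ eₖ₊₁ d d′ →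
      eₖ₊₁ :- d′
        := con 1ℚ :* (eₖ₊₁ :- (con (+ 2 ℚ./ 1) :* eₖ :- e₀))
           :+ :- con 1ℚ :* (d′ :- (d :+ p :* eₖ))
           :+ :- eₖ :* (α :+ p :- con (+ 2 ℚ./ 1))
           :+ α :* (eₖ :- r :* (e₀ :+ d))
           :+ (e₀ :+ d) :* (α :* r :- con 1ℚ))
      ≈-refl α r (r ^ suc m) (e 0) (e (suc m)) (e (2 ℕ.+ m))
        (discount r m (e ∘ suc)) (discount r (suc m) (e ∘ suc)))

  discount-const≈ : ∀ c → discount r (suc m) (λ _ → c) ≈ c
  discount-const≈ c = R.trans (discount-const r (suc m) c)
    (R.trans (*-cong ≈-refl total) (R.*-identityʳ c))

  -- The induction shifts the whole sequence, so the hypotheses always concern its first terms. The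
  -- value entering the window is a mean, with positive weights of sum 1, of values between a and b.
  stays-between : ∀ {a b} e →
    (∀ t → e (t ℕ.+ (2 ℕ.+ m)) ≈ fromℕ 2 * e (t ℕ.+ suc m) - e t) →
    e (suc m) ≈ discount r (suc m) e →
    (∀ i → i ℕ.< suc m → a < e i × e i < b) →
    ∀ t → a < e t × e t < b
  stays-between e rec balanced initial zero = initial 0 ℕ.z<s
  stays-between {a} {b} e rec balanced initial (suc t) = stays-between (e ∘ suc)
    (λ t → rec (suc t)) (discount-step e (rec 0) balanced) next t
    where
    next : ∀ i → i ℕ.< suc m → a < e (suc i) × e (suc i) < b
    next i i<k with ℕ.m≤n⇒m<n∨m≡n i<k
    ... | inj₁ 1+i<k = initial (suc i) 1+i<k
    ... | inj₂ refl  =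
      <-resp-≈ (discount-const≈ a) (R.sym balanced)
        (discount-mono-< r 0<r m λ i i<k → proj₁ (initial i i<k)) ,
      <-resp-≈ (R.sym balanced) (discount-const≈ b)
        (discount-mono-< r 0<r m λ i i<k → proj₂ (initial i i<k))

-- Initial values and the three-term recurrence of the Fibonacci numbers.

back-suc : ∀ k n i → back k (suc n) (suc i) ≡ back k n i
back-suc k zero    i = refl
back-suc k (suc n) i = refl

back-+ : ∀ k i n → back k (i ℕ.+ n) i ≡ back k n 0
back-+ k zero    n = refl
back-+ k (suc i) n = trans (back-suc k (i ℕ.+ n) i) (back-+ k i n)

back-0 : ∀ k {n i} → n ℕ.≤ i → back k n i ≡ + 0
back-0 k ℕ.z≤n = refl
back-0 k (ℕ.s≤s {n} {i} n≤i) = trans (back-suc k n i) (back-0 k n≤i)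

back-first : ∀ k m → back k (suc m) m ≡ + 1
back-first k m = trans (cong (λ n → back k n m) (ℕ.+-comm 1 m)) (back-+ k m 1)

back-second : ∀ m → back (2 ℕ.+ m) (2 ℕ.+ m) m ≡ + 1
back-second m = trans (cong (λ n → back (2 ℕ.+ m) n m) (ℕ.+-comm 2 m)) (trans
  (back-+ (2 ℕ.+ m) m 2)
  (cong (λ s → + 1 ℤ.+ s) (MonoidSum.sum-replicate-zero ℤ.+-0-monoid (suc m))))

-- The second summand on the left completes all terms but the first of the sum for index n + 3 to
-- the full sum for index n + 2.
back-recurrence₀ : ∀ m n →
  back (suc m) (3 ℕ.+ n) 0 ℤ.+ back (suc m) (suc n) m
    ≡ back (suc m) (2 ℕ.+ n) 0 ℤ.+ back (suc m) (2 ℕ.+ n) 0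
back-recurrence₀ m n = trans (ℤ.+-assoc (back (suc m) (2 ℕ.+ n) 0) _ _)
  (cong (λ s → back (suc m) (2 ℕ.+ n) 0 ℤ.+ s)
    (sym (sum-toℕ-last ℤ.+-0-monoid (back (suc m) (suc n)) m)))

-- The fixed offset m lets t range over all naturals while the index t - m starts at 2 - k.
back-recurrence : ∀ m t → let k = 2 ℕ.+ m in
  back k (t ℕ.+ (3 ℕ.+ m)) m ℤ.+ back k t m
    ≡ back k (t ℕ.+ (2 ℕ.+ m)) m ℤ.+ back k (t ℕ.+ (2 ℕ.+ m)) m
back-recurrence m t = trans
  (cong₂ ℤ._+_ (strip 3) (sym (back-suc k t m)))
  (trans (back-recurrence₀ (suc m) t) (sym (cong₂ ℤ._+_ (strip 2) (strip 2))))
  where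
  k = 2 ℕ.+ m

  strip : ∀ j → back k (t ℕ.+ (j ℕ.+ m)) m ≡ back k (j ℕ.+ t) 0
  strip j = trans
    (cong (λ n → back k n m) (trans (sym (ℕ.+-assoc t j m))
      (trans (ℕ.+-comm (t ℕ.+ j) m) (cong (m ℕ.+_) (ℕ.+-comm t j)))))
    (back-+ k m (j ℕ.+ t))

-- Size of r and sign of the denominator.

module _ {α r : ℝ} (αr≈1 : α * r ≈ 1ℝ) (0<r : 0ℝ < r) (m : ℕ)
         (total : discount r (2 ℕ.+ m) (λ _ → 1ℝ) ≈ 1ℝ) where

  r<1 : r < 1ℝ
  r<1 = <-trans (r<⅔ 0<r m total) (<-from-difference (0<fromℚ (ℚ.positive⁻¹ (+ 1 ℚ./ 3)))
    (solve 0 (con (+ 1 ℚ./ 3) := con 1ℚ :- con (+ 2 ℚ./ 3)) ≈-refl))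

  0<r^ : ∀ n → 0ℝ < r ^ n
  0<r^ zero    = 0<fromℚ 0<1
  0<r^ (suc n) = 0<* 0<r (0<r^ n)

  -- At n = m this is equivalent to g r < ½.
  weight<2 : ∀ n → (fromℕ 2 + fromℕ (suc n)) * r ^ suc n < fromℕ 2
  weight<2 zero = <-from-difference
    (0<* (0<fromℚ (ℚ.positive⁻¹ (+ 3 ℚ./ 1))) (<⇒0<- (r<⅔ 0<r m total)))
    (solve 1 (λ r → con (+ 3 ℚ./ 1) :* (con (+ 2 ℚ./ 3) :- r)
      := con (+ 2 ℚ./ 1) :- (con (+ 2 ℚ./ 1) :+ con (+ 1 ℚ./ 1)) :* (r :* con 1ℚ))
      ≈-refl r)
  -- The left side decreases with n: for N = n + 1, (2 + N) - (3 + N) r = N (1 - r) + 3 (⅔ - r) is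
  -- positive. The base case 3 r < 2 is the bound ⅔ itself.
  weight<2 (suc n) = <-from-difference
    (0<+ (<⇒0<- (weight<2 n)) (0<* (0<r^ (suc n))
      (0<+ (0<* (0<fromℕ-suc n) (<⇒0<- r<1))
        (0<* (0<fromℚ (ℚ.positive⁻¹ (+ 3 ℚ./ 1))) (<⇒0<- (r<⅔ 0<r m total))))))
    (linear ((r * r ^ suc n) · fromℕ-suc (suc n))
      (solve 4 (λ r p N N′ →
        con (+ 2 ℚ./ 1) :- (con (+ 2 ℚ./ 1) :+ N) :* p
          :+ p :* (N :* (con 1ℚ :- r) :+ con (+ 3 ℚ./ 1) :* (con (+ 2 ℚ./ 3) :- r))
          :- (con (+ 2 ℚ./ 1) :- (con (+ 2 ℚ./ 1) :+ N′) :* (r :* p))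
          := r :* p :* (N′ :- (con 1ℚ :+ N)))
        ≈-refl r (r ^ suc n) (fromℕ (suc n)) (fromℕ (2 ℕ.+ n))))

  private
    k = 2 ℕ.+ m
    Q = r ^ suc m
    M = fromℕ (suc m)

    α+rQ≈2 : α + r * Q ≈ fromℕ 2
    α+rQ≈2 = α+rᵏ≈2 α r αr≈1 (suc m) total

    k≈1+M : fromℕ k ≈ 1ℝ + M
    k≈1+M = fromℕ-suc (suc m)

    k+1≈2+M : fromℕ (k ℕ.+ 1) ≈ fromℕ 2 + M
    k+1≈2+M = R.trans (fromℤ-homo-+ (+ k) (+ 1)) (linear (1ℝ · k≈1+M)
      (solve 2 (λ K M → K :+ con 1ℚ :- (con (+ 2 ℚ./ 1) :+ M)
        := con 1ℚ :* (K :- (con 1ℚ :+ M))) ≈-refl (fromℕ k) M))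

    0<2-weight : 0ℝ < fromℕ 2 - (fromℕ 2 + M) * Q
    0<2-weight = <⇒0<- (weight<2 m)

  -- Since α - 2 = - rᵏ, the denominator is 2 - (k + 1) rᵏ = r (2 - (k + 1) rᵏ⁻¹) + 2 (1 - r).
  0<denominator : 0ℝ < denominator k α
  0<denominator = 0<-resp-≈
    (linear ((- (fromℕ 2 + M)) · α+rQ≈2 ⊕ (- (α - fromℕ 2)) · k+1≈2+M)
      (solve 5 (λ α r Q M K →
        r :* (two :- (two :+ M) :* Q) :+ two :* (con 1ℚ :- r) :- (two :+ K :* (α :- two))
          := :- (two :+ M) :* (α :+ r :* Q :- two)
             :+ :- (α :- two) :* (K :- (two :+ M)))
        ≈-refl α r Q M (fromℕ (k ℕ.+ 1))))
    (0<+ (0<* 0<r 0<2-weight) (0<* (0<fromℕ-suc 1) (<⇒0<- r<1)))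
    where
    two : ∀ {n} → Polynomial n
    two = con (+ 2 ℚ./ 1)

  -- Bounds on the coefficient g and on the error.

  module _ (0<α : 0ℝ < α) (D : ℝ) (dD≈1 : denominator k α * D ≈ 1ℝ) (0<D : 0ℝ < D) where

    private
      two ½′ : ∀ {n} → Polynomial n
      two   = con (+ 2 ℚ./ 1)
      ½′ = con ½

      g = (α - 1ℝ) * D

      dD≈1′ : (fromℕ 2 + (fromℕ 2 + M) * (α - fromℕ 2)) * D ≈ 1ℝ
      dD≈1′ = linear (1ℝ · dD≈1 ⊕ (- ((α - fromℕ 2) * D)) · k+1≈2+M)
        (solve 4 (λ α D M K →
          (two :+ (two :+ M) :* (α :- two)) :* D :- con 1ℚ
            := con 1ℚ :* ((two :+ K :* (α :- two)) :* D :- con 1ℚ)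
               :+ :- ((α :- two) :* D) :* (K :- (two :+ M)))
          ≈-refl α D M (fromℕ (k ℕ.+ 1)))

    0<g : 0ℝ < g
    0<g = 0<* (<-from-difference (0<* 0<α (<⇒0<- r<1)) (linear ((- 1ℝ) · αr≈1)
      (solve 2 (λ α r → α :* (con 1ℚ :- r) :- ((α :- con 1ℚ) :- con 0ℚ)
        := :- con 1ℚ :* (α :* r :- con 1ℚ)) ≈-refl α r))) 0<D

    -- For p = rᵏ one has α - 1 = 1 - p and the denominator is 2 - (k + 1) p, so that g - ½ = D p (k
    -- - 1) / 2.
    ½<g : ½ℝ < g
    ½<g = <-from-difference (0<* 0<D (0<* (0<* 0<½ (0<r^ k)) (0<fromℕ-suc m)))
      (linear ((- ½ℝ) · dD≈1′ ⊕ (½ℝ * D * M) · α+rQ≈2)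
        (solve 5 (λ α r Q M D →
          D :* (½′ :* (r :* Q) :* M) :- ((α :- con 1ℚ) :* D :- ½′)
            := :- ½′ :* ((two :+ (two :+ M) :* (α :- two)) :* D :- con 1ℚ)
               :+ ½′ :* D :* M :* (α :+ r :* Q :- two))
          ≈-refl α r Q M D))

    -- The same substitution gives ½ - g r = D r (2 - (k + 1) rᵏ⁻¹) / 2, whose last factor is
    -- positive by `weight<2`.
    gr<½ : g * r < ½ℝ
    gr<½ = <-from-difference (0<* 0<D (0<* 0<r (0<* 0<½ 0<2-weight)))
      (linear (D · αr≈1 ⊕ (- (½ℝ * D * (fromℕ 2 + M))) · α+rQ≈2 ⊕ ½ℝ · dD≈1′)
        (solve 5 (λ α r Q M D →
          D :* (r :* (½′ :* (two :- (two :+ M) :* Q))) :- (½′ :- (α :- con 1ℚ) :* D :* r)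
            := D :* (α :* r :- con 1ℚ)
               :+ :- (½′ :* D :* (two :+ M)) :* (α :+ r :* Q :- two)
               :+ ½′ :* ((two :+ (two :+ M) :* (α :- two)) :* D :- con 1ℚ))
          ≈-refl α r Q M D))

    -- From `gr<½`, g < α/2 = 1 - rᵏ/2.
    g<3/2 : g < fromℚ (+ 3 ℚ./ 2)
    g<3/2 = <-from-difference
      (0<+ (0<+ (0<* 0<α (<⇒0<- gr<½)) (0<* 0<½ (0<r^ k))) 0<½)
      (linear ((- g) · αr≈1 ⊕ ½ℝ · α+rQ≈2)
        (solve 4 (λ α r Q g →
          α :* (½′ :- g :* r) :+ ½′ :* (r :* Q) :+ ½′ :- (con (+ 3 ℚ./ 2) :- g)
            := :- g :* (α :* r :- con 1ℚ) :+ ½′ :* (α :+ r :* Q :- two))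
          ≈-refl α r Q g))

    gr^<½ : ∀ n → g * r ^ suc n < ½ℝ
    gr^<½ zero    = <-resp-≈ (*-cong ≈-refl (R.sym (R.*-identityʳ r))) ≈-refl gr<½
    gr^<½ (suc n) = <-trans
      (<-from-difference (0<* (0<* 0<g (0<r^ (suc n))) (<⇒0<- r<1))
        (solve 3 (λ g r p → g :* p :* (con 1ℚ :- r) := g :* p :- g :* (r :* p))
          ≈-refl g r (r ^ suc n)))
      (gr^<½ n)

    -- error t is the error at n = t - m: the value t = 0 corresponds to n = 2 - k,
    -- and c * α ^ t to g αⁿ⁻¹.
    c : ℝ
    c = g * Q

    error : ℕ → ℝ
    error t = fromℤ (back k t m) - c * α ^ t

    -- Multiplying α + rᵏ = 2 by αᵏ gives αᵏ⁺¹ + 1 = 2 αᵏ.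
    ^-recurrence : ∀ t →
      α ^ (t ℕ.+ (3 ℕ.+ m)) ≈ fromℕ 2 * α ^ (t ℕ.+ (2 ℕ.+ m)) - α ^ t
    ^-recurrence t = linear
      (1ℝ · ^-homo-* α t (3 ℕ.+ m) ⊕ (- fromℕ 2) · ^-homo-* α t (2 ℕ.+ m)
        ⊕ (α ^ t * α ^ k) · α+rQ≈2 ⊕ (- α ^ t) · ^-inverse α r αr≈1 k)
      (solve 6 (λ α p p₃ p₂ P q →
        p₃ :- (two :* p₂ :- p)
          := con 1ℚ :* (p₃ :- p :* (α :* P)) :+ :- two :* (p₂ :- p :* P)
             :+ p :* P :* (α :+ q :- two) :+ :- p :* (q :* P :- con 1ℚ))
        ≈-refl α (α ^ t) (α ^ (t ℕ.+ (3 ℕ.+ m))) (α ^ (t ℕ.+ (2 ℕ.+ m))) (α ^ k) (r * Q))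

    error-recurrence : ∀ t →
      error (t ℕ.+ (3 ℕ.+ m)) ≈ fromℕ 2 * error (t ℕ.+ (2 ℕ.+ m)) - error t
    error-recurrence t = linear
      (1ℝ · R.trans (R.sym (fromℤ-homo-+ A C)) (R.trans
          (R.reflexive (cong fromℤ (back-recurrence m t))) (fromℤ-homo-+ B B))
        ⊕ (- c) · ^-recurrence t)
      (solve 7 (λ A B C c p p₃ p₂ →
        (A :- c :* p₃) :- (two :* (B :- c :* p₂) :- (C :- c :* p))
          := con 1ℚ :* ((A :+ C) :- (B :+ B)) :+ :- c :* (p₃ :- (two :* p₂ :- p)))
        ≈-refl (fromℤ A) (fromℤ B) (fromℤ C) c (α ^ t) (α ^ (t ℕ.+ (3 ℕ.+ m)))
          (α ^ (t ℕ.+ (2 ℕ.+ m))))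
      where
      A = back k (t ℕ.+ (3 ℕ.+ m)) m
      B = back k (t ℕ.+ (2 ℕ.+ m)) m
      C = back k t m

    -- Among the first k Fibonacci values only the last, at n = 1, is nonzero; it has weight rᵏ. The
    -- geometric part contributes k equal terms.
    discount-error : discount r k error ≈ r * Q - (1ℝ + M) * (c * r)
    discount-error = R.trans (discount-- r k G (λ t → c * α ^ t)) (+-cong G-part
      (-‿cong (R.trans (discount-geometric α r αr≈1 k c (λ t → c * α ^ t) (λ _ → ≈-refl))
        (*-cong k≈1+M ≈-refl))))
      where
      G : ℕ → ℝ
      G t = fromℤ (back k t m)

      G-part : discount r k G ≈ r * Q
      G-part = R.trans (discount-last r (suc m) G) (R.trans
        (+-cong
          (discount-0 r (suc m) G λ t t<1+m →
            R.reflexive (cong fromℤ (back-0 k (ℕ.≤-pred t<1+m))))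
          (*-cong ≈-refl (R.reflexive (cong fromℤ (back-first k m)))))
        (R.trans (R.+-identityˡ _) (R.*-identityʳ (r * Q))))

    -- The choice of g makes this hold: the equation reads 1 - g α = rᵏ - k g rᵏ, and replacing rᵏ
    -- by 2 - α turns it into α - 1 = g (2 + (k + 1) (α - 2)).
    error-balanced : error k ≈ discount r k error
    error-balanced = R.trans (linear
      (1ℝ · R.reflexive (cong fromℤ (back-second m))
        ⊕ (- (g * α)) · ^-inverse α r αr≈1 (suc m)
        ⊕ ((1ℝ + M) * g - 1ℝ) · α+rQ≈2
        ⊕ (- (α - 1ℝ)) · dD≈1′)
      (solve 7 (λ α r Q M D P G₂ → let g = (α :- con 1ℚ) :* D in
        (G₂ :- g :* Q :* (α :* P)) :- (r :* Q :- (con 1ℚ :+ M) :* (g :* Q :* r))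
          := con 1ℚ :* (G₂ :- con 1ℚ) :+ :- (g :* α) :* (Q :* P :- con 1ℚ)
             :+ ((con 1ℚ :+ M) :* g :- con 1ℚ) :* (α :+ r :* Q :- two)
             :+ :- (α :- con 1ℚ) :* ((two :+ (two :+ M) :* (α :- two)) :* D :- con 1ℚ))
        ≈-refl α r Q M D (α ^ suc m) (fromℤ (back k k m))))
      (R.sym discount-error)

    ^-cancel : ∀ t s → r ^ suc (t ℕ.+ s) * α ^ t ≈ r ^ suc s
    ^-cancel zero    s = R.*-identityʳ (r ^ suc s)
    ^-cancel (suc t) s = linear
      ((r ^ suc (t ℕ.+ s) * α ^ t) · αr≈1 ⊕ 1ℝ · ^-cancel t s)
      (solve 5 (λ α r p q s →
        r :* p :* (α :* q) :- s := p :* q :* (α :* r :- con 1ℚ) :+ con 1ℚ :* (p :* q :- s))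
        ≈-refl α r (r ^ suc (t ℕ.+ s)) (α ^ t) (r ^ suc s))

    -- For t ≤ m the index n = t - m is at most 0, so the error is - g r¹⁻ⁿ; t = m + 1 is n = 1,
    -- with error 1 - g.
    error-initial : ∀ t → t ℕ.< k → - ½ℝ < error t × error t < ½ℝ
    error-initial t t<k with ℕ.m≤n⇒m<n∨m≡n (ℕ.≤-pred t<k)
    ... | inj₁ t<1+m =
      <-resp-≈ ≈-refl (R.sym error≈) (<-from-difference (<⇒0<- (gr^<½ s))
        (solve 1 (λ h → ½′ :- h := :- h :- :- ½′) ≈-refl (g * r ^ suc s))) ,
      <-resp-≈ (R.sym error≈) ≈-refl (<-from-difference (0<+ (0<* 0<g (0<r^ (suc s))) 0<½)
        (solve 1 (λ h → h :+ ½′ := ½′ :- :- h) ≈-refl (g * r ^ suc s)))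
      where
      t≤m = ℕ.≤-pred t<1+m
      s = m ℕ.∸ t

      error≈ : error t ≈ - (g * r ^ suc s)
      error≈ = linear
        (1ℝ · R.reflexive (cong fromℤ (back-0 k t≤m))
          ⊕ (- g) · subst (λ n → r ^ suc n * α ^ t ≈ r ^ suc s)
                          (ℕ.m+[n∸m]≡n t≤m) (^-cancel t s))
        (solve 5 (λ G g Q p q →
          (G :- g :* Q :* p) :- :- (g :* q)
            := con 1ℚ :* (G :- con 0ℚ) :+ :- g :* (Q :* p :- q))
          ≈-refl (fromℤ (back k t m)) g Q (α ^ t) (r ^ suc s))
    ... | inj₂ refl =
      <-resp-≈ ≈-refl (R.sym error≈) (<-from-difference (<⇒0<- g<3/2)
        (solve 1 (λ g → con (+ 3 ℚ./ 2) :- g := con 1ℚ :- g :- :- ½′) ≈-refl g)) ,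
      <-resp-≈ (R.sym error≈) ≈-refl (<-from-difference (<⇒0<- ½<g)
        (solve 1 (λ g → g :- ½′ := ½′ :- (con 1ℚ :- g)) ≈-refl g))
      where
      error≈ : error (suc m) ≈ 1ℝ - g
      error≈ = linear
        (1ℝ · R.reflexive (cong fromℤ (back-first k m))
          ⊕ (- g) · ^-inverse α r αr≈1 (suc m))
        (solve 4 (λ G g Q p →
          (G :- g :* Q :* p) :- (con 1ℚ :- g)
            := con 1ℚ :* (G :- con 1ℚ) :+ :- g :* (Q :* p :- con 1ℚ))
          ≈-refl (fromℤ (back k (suc m) m)) g Q (α ^ suc m))

    error-bound : ∀ t → - ½ℝ < error t × error t < ½ℝ
    error-bound = stays-between αr≈1 0<r (suc m) total error
      error-recurrence error-balanced error-initial

-- Integer exponents and the rounding formula.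

zpow-⊖ : ∀ α (0<α : 0ℝ < α) m n →
         zpow α (inj₂ 0<α) (m ℤ.⊖ n) ≈ α ^ m * inv α (inj₂ 0<α) ^ n
zpow-⊖ α 0<α zero    zero    = R.sym (R.*-identityˡ 1ℝ)
zpow-⊖ α 0<α zero    (suc n) = R.sym (R.*-identityˡ _)
zpow-⊖ α 0<α (suc m) zero    = R.sym (R.*-identityʳ _)
zpow-⊖ α 0<α (suc m) (suc n) = R.trans
  (R.reflexive (cong (zpow α (inj₂ 0<α)) (ℤ.[1+m]⊖[1+n]≡m⊖n m n)))
  (linear (1ℝ · zpow-⊖ α 0<α m n
      ⊕ (- (α ^ m * r ^ n)) · inv-inverseʳ α (inj₂ 0<α))
    (solve 5 (λ α r p q z → z :- α :* p :* (r :* q)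
      := con 1ℚ :* (z :- p :* q) :+ :- (p :* q) :* (α :* r :- con 1ℚ))
      ≈-refl α r (α ^ m) (r ^ n) (zpow α (inj₂ 0<α) (m ℤ.⊖ n))))
  where r = inv α (inj₂ 0<α)

-- For k = m + 2 the lower end 2 - k is - m, so the shift by m matches the range with the naturals.
2-k≤n⇒n≡t⊖m : ∀ m {n} → + 2 ℤ.- + (2 ℕ.+ m) ℤ.≤ n → Σ[ t ∈ ℕ ] n ≡ t ℤ.⊖ m
2-k≤n⇒n≡t⊖m m 2-k≤n with t , n≡ ← i≤j⇒j≡i+n 2-k≤n = t , trans n≡ (trans
  (ℤS.solve 2 (λ m t → let two = ℤS.con (+ 2) in
    (two ℤS.:- (two ℤS.:+ m)) ℤS.:+ t ℤS.:= t ℤS.:- m) refl (+ m) (+ t))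
  (ℤ.m-n≡m⊖n t m))

t⊖m-1≡t⊖1+m : ∀ t m → t ℤ.⊖ m ℤ.- + 1 ≡ t ℤ.⊖ suc m
t⊖m-1≡t⊖1+m t m = trans (cong (ℤ._- + 1) (sym (ℤ.m-n≡m⊖n t m))) (trans
  (ℤS.solve 2 (λ m t → let one = ℤS.con (+ 1) in
    (t ℤS.:- m) ℤS.:- one ℤS.:= t ℤS.:- (one ℤS.:+ m)) refl (+ m) (+ t))
  (ℤ.m-n≡m⊖n t (suc m)))

F-rounds : ∀ m α (0<α : 0ℝ < α) → charPoly (2 ℕ.+ m) α ≈ 0ℝ →
           (0<d : 0ℝ < denominator (2 ℕ.+ m) α) → ∀ t →
           F (2 ℕ.+ m) (t ℤ.⊖ m)
             ≡Round[ (α - 1ℝ) * inv (denominator (2 ℕ.+ m) α) (inj₂ 0<d)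
                     * zpow α (inj₂ 0<α) (t ℤ.⊖ m ℤ.- + 1) ]
F-rounds m α 0<α root 0<d t = within-½⇒Round
  (<-resp-≈ ≈-refl error≈ (proj₁ bound)) (<-resp-≈ error≈ ≈-refl (proj₂ bound))
  where
  k = 2 ℕ.+ m
  r = inv α (inj₂ 0<α)
  αr≈1 = inv-inverseʳ α (inj₂ 0<α)
  D = inv (denominator k α) (inj₂ 0<d)
  g = (α - 1ℝ) * D

  bound : - ½ℝ < fromℤ (back k t m) - g * r ^ suc m * α ^ t
        × fromℤ (back k t m) - g * r ^ suc m * α ^ t < ½ℝ
  bound = error-bound αr≈1 (0<inv 0<α) m (discount-1 α r αr≈1 k root) 0<α D
    (inv-inverseʳ (denominator k α) (inj₂ 0<d)) (0<inv 0<d) t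

  error≈ : fromℤ (back k t m) - g * r ^ suc m * α ^ t
         ≈ fromℤ (F k (t ℤ.⊖ m)) - g * zpow α (inj₂ 0<α) (t ℤ.⊖ m ℤ.- + 1)
  -- The exponent n - 1 is `t ⊖ suc m`, so αⁿ⁻¹ is `α ^ t * r ^ suc m`.
  error≈ = +-cong (R.reflexive (cong fromℤ (back≡F k t m))) (-‿cong (R.trans
    (R.*-assoc g (r ^ suc m) (α ^ t))
    (*-cong ≈-refl (R.trans (R.*-comm (r ^ suc m) (α ^ t)) (R.sym (R.trans
      (R.reflexive (cong (zpow α (inj₂ 0<α)) (t⊖m-1≡t⊖1+m t m)))
      (zpow-⊖ α 0<α t (suc m))))))))

theorem2 : (k : ℕ) → 2 ℕ.≤ k →
    (α : ℝ) (0<α : 0ℝ < α) → charPoly k α ≈ 0ℝ →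
    Σ[ d#0 ∈ denominator k α # 0ℝ ]
    ((n : ℤ) → + 2 ℤ.- + k ℤ.≤ n →
    F k n ≡Round[ (α - 1ℝ) * inv (denominator k α) d#0 * zpow α (inj₂ 0<α) (n ℤ.- + 1) ])
theorem2 k@(suc (suc m)) (ℕ.s≤s (ℕ.s≤s ℕ.z≤n)) α 0<α root = inj₂ 0<d , λ n 2-k≤n →
  let t , n≡t⊖m = 2-k≤n⇒n≡t⊖m m 2-k≤n
  in subst (λ n → F k n ≡Round[ (α - 1ℝ) * inv (denominator k α) (inj₂ 0<d)
                                * zpow α (inj₂ 0<α) (n ℤ.- + 1) ])
       (sym n≡t⊖m) (F-rounds m α 0<α root 0<d t)
  where
  r = inv α (inj₂ 0<α)
  αr≈1 = inv-inverseʳ α (inj₂ 0<α)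
  0<d = 0<denominator αr≈1 (0<inv 0<α) m (discount-1 α r αr≈1 k root)
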